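{- Let $X$ be a set of seeds (closed under isomorphism) all of which are primitive, and let $G$ be the garden of $X$. Let $O(x)=\sum_n o_n x^n$, where $o_n$ is the number of isomorphism classes of $n$-element posets in $G$; let $E(x)=\sum_n e_n x^n/n!$, where $e_n$ is the number of posets on the vertex set $[n]$ belonging to $G$; and let $S(x)=\sum_n s_n x^n/n!$, where $s_n$ is the number of posets on $[n]$ belonging to $X$. Then \[E(x)=S(e^x-1),\qquad E(x)=O(1-e^{ -x}),\qquad O(x)=S\!\left(\frac{x}{1-x}\right).\]
   Context: All posets are finite. Two incomparable elements $x,x'$ of a poset $P$ are exchangeable if for all $y\in P$: $x<y$ iff $x'<y$, and $x>y$ iff $x'>y$. Cloning at $x$ produces a poset $P'$ obtained by adding a new element $x'$ exchangeable with $x$. A seed is a poset with no pair of exchangeable elements. $P$ is a sprout of $Q$ if $P$ can be obtained from $Q$ by a finite (possibly empty) sequence of cloning operations. The garden of a set $X$ of seeds is the set of all sprouts of members of $X$. A poset is primitive if it has no nontrivial automorphism. -}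

module Defs where

open import Data.Nat using (ℕ; zero; suc; _∸_; _!)
open import Data.Nat.Properties using (_!≢0)
open import Data.Integer using (ℤ; +_)
open import Data.Rational using (ℚ; 0ℚ; 1ℚ; _+_; _*_; -_; _/_)
open import Data.Fin using (Fin; punchIn)
open import Data.Vec using (Vec; lookup)
open import Data.Bool using (Bool; true)
open import Data.List using (List; foldr; map; upTo; length)
open import Data.List.Relation.Unary.All using (All)
open import Data.List.Relation.Unary.Any using (Any)
open import Data.List.Relation.Unary.Unique.Propositional using (Unique)
open import Data.List.Relation.Unary.AllPairs using (AllPairs)
open import Data.List.Membership.Propositional using (_∈_)
open import Data.Product using (Σ; ∃; ∃₂; _×_)
open import Relation.Binary.PropositionalEquality using (_≡_; _≢_)
open import Relation.Nullary using (¬_)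
open import Function.Bundles using (_⇔_)

-- Finite posets.  A finite poset with n elements is represented (up to
-- relabelling) by a strict order on the carrier Fin n, given as an
-- n×n Boolean matrix:  i < j  iff  entry (i , j) is true.

BRel : ℕ → Set
BRel n = Vec (Vec Bool n) n

_⊢_<_ : ∀ {n} → BRel n → Fin n → Fin n → Set
R ⊢ i < j = lookup (lookup R i) j ≡ true

IsPoset : ∀ {n} → BRel n → Set
IsPoset {n} R = (∀ (i : Fin n) → ¬ (R ⊢ i < i))
              × (∀ (i j k : Fin n) → R ⊢ i < j → R ⊢ j < k → R ⊢ i < k)

record Iso {n m} (P : BRel n) (Q : BRel m) : Set where
  field
    to       : Fin n → Fin m
    from     : Fin m → Fin n
    from∘to  : ∀ i → from (to i) ≡ i
    to∘from  : ∀ j → to (from j) ≡ j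
    preserve : ∀ i j → (P ⊢ i < j) ⇔ (Q ⊢ to i < to j)

Exchangeable : ∀ {n} → BRel n → Fin n → Fin n → Set
Exchangeable {n} P x x' =
  x ≢ x' × ¬ (P ⊢ x < x') × ¬ (P ⊢ x' < x)
  × (∀ (y : Fin n) → ((P ⊢ x < y) ⇔ (P ⊢ x' < y)) × ((P ⊢ y < x) ⇔ (P ⊢ y < x')))

IsSeed : ∀ {n} → BRel n → Set
IsSeed P = ∀ x x' → ¬ Exchangeable P x x'

IsPrimitive : ∀ {n} → BRel n → Set
IsPrimitive P = (f : Iso P P) → ∀ i → Iso.to f i ≡ i

delete : ∀ {n} → BRel (suc n) → Fin (suc n) → BRel n
delete R v = Data.Vec.tabulate λ i → Data.Vec.tabulate λ j →
  lookup (lookup R (punchIn v i)) (punchIn v j)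

IsCloneOf : ∀ {n} → BRel (suc n) → BRel n → Set
IsCloneOf P' P = ∃₂ λ x x' → Exchangeable P' x x' × Iso (delete P' x') P

data Sprout : ∀ {m n} → BRel m → BRel n → Set where
  here  : ∀ {n} {Q : BRel n} → Sprout Q Q
  clone : ∀ {m n} {P' : BRel (suc m)} {P : BRel m} {Q : BRel n} →
          IsCloneOf P' P → Sprout P Q → Sprout P' Q

PosetClass : Set₁
PosetClass = ∀ {n} → BRel n → Set

Garden : PosetClass → PosetClass
Garden X P = Σ ℕ λ k → Σ (BRel k) λ Q → X Q × Sprout P Q

LabelledCount : PosetClass → ℕ → ℕ → Set
LabelledCount C n c = Σ (List (BRel n)) λ L →
  Unique L × length L ≡ c × (∀ (R : BRel n) → (R ∈ L) ⇔ (IsPoset R × C R))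

IsoClassCount : PosetClass → ℕ → ℕ → Set
IsoClassCount C n c = Σ (List (BRel n)) λ L →
  AllPairs (λ P Q → ¬ Iso P Q) L × length L ≡ c
  × All (λ R → IsPoset R × C R) L
  × (∀ (R : BRel n) → IsPoset R → C R → Any (Iso R) L)

PS : Set
PS = ℕ → ℚ

sumℚ : List ℚ → ℚ
sumℚ = foldr _+_ 0ℚ

_·_ : PS → PS → PS
(f · g) n = sumℚ (map (λ k → f k * g (n ∸ k)) (upTo (suc n)))

pow : PS → ℕ → PS
pow f zero zero    = 1ℚ
pow f zero (suc n) = 0ℚ
pow f (suc k)      = f · pow f k

-- composition f(g(x)), meaningful when g has zero constant term
-- (then only k ≤ n contributes to the coefficient of x^n)
_∘ₚ_ : PS → PS → PS
(f ∘ₚ g) n = sumℚ (map (λ k → f k * pow g k n) (upTo (suc n)))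

invFact : ℕ → ℚ
invFact n = (+ 1) / (n !) where instance _ = n !≢0

expm1 : PS
expm1 zero    = 0ℚ
expm1 (suc n) = invFact (suc n)

sign : ℕ → ℚ
sign zero    = 1ℚ
sign (suc n) = - sign n

oneMinusExpNeg : PS
oneMinusExpNeg zero    = 0ℚ
oneMinusExpNeg (suc n) = sign n * invFact (suc n)

-- x / (1 - x) = Σ_{n≥1} x^n
geomx : PS
geomx zero    = 0ℚ
geomx (suc n) = 1ℚ

egf : (ℕ → ℕ) → PS
egf a n = ((+ a n) / 1) * invFact n

ogf : (ℕ → ℕ) → PS
ogf a n = (+ a n) / 1

{-# OPTIONS --safe #-}
module Submission where

-- Every garden poset P is the pullback f*Q of a seed Q ∈ X on k points along a
-- surjection f, whose fibres are the classes of equal or exchangeable elements.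
-- Choosing f to be a restricted growth string makes (Q, f) unique, so
-- e_n = Σ_k s_k S₂(n,k).  Up to isomorphism, P is determined by the class of Q
-- and the fibre sizes, and as Q is primitive these form a composition of n into
-- k parts that is itself determined by P.  Hence o_n = Σ_k t_k c(n,k) and
-- s_k = k! t_k, where t_k counts the isomorphism classes of X on k points.
-- The series identities follow from [xⁿ](eˣ − 1)ᵏ = k! S₂(n,k)/n! (obtained by
-- differentiating) and [xⁿ](x/(1−x))ᵏ = c(n,k); with u = 1 − e⁻ˣ and
-- v = eˣ − 1 one has v = u + uv, which gives Σ_j c(j,k) uʲ = vᵏ.

-- The numbers t_k are not among the data, and membership in X may be undecidable. Being a seed is
-- decidable, and a garden member lies in X exactly when it is a seed, so t_k is obtained by
-- filtering the representatives that count the garden. The uniqueness claims rest on one fact: when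
-- P is the pullback of a seed along a surjection, the fibres are the twin classes of P, so an
-- isomorphism of two such posets descends to an isomorphism of the seeds compatible with the
-- surjections. Primitivity enters when this descended map is an automorphism: being the identity,
-- it keeps the k! labellings of a seed distinct and forbids permuting the parts by symmetry.

open import Defs
open import Data.Bool using (Bool; true)
import Data.Bool.Properties as Bool
open import Data.Empty using (⊥-elim)
open import Data.Fin using (Fin; zero; suc; punchIn; punchOut; remQuot; combine)
open import Data.Fin.Permutation as Perm using (Permutation; _⟨$⟩ʳ_; _⟨$⟩ˡ_; lift₀) renaming (_∘ₚ_ to _⨾_)
open import Data.Fin.Properties
  using (_≟_; any?; all?; suc-injective; punchInᵢ≢i; punchIn-injective; punchIn-punchOut; punchOut-punchIn;
         punchOut-cong; injective⇒≤; remQuot-combine; combine-remQuot; +↔⊎; *↔×)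
import Data.Integer as ℤ
import Data.Integer.Properties as ℤ
open import Data.List using ([]; _∷_; length; filter; applyUpTo) renaming (lookup to _!!_)
open import Data.List.Membership.Propositional.Properties using (∈-lookup)
open import Data.List.Properties using (map-upTo)
open import Data.List.Relation.Unary.All as All using ([]; _∷_)
import Data.List.Relation.Unary.All.Properties as All
open import Data.List.Relation.Unary.AllPairs using (AllPairs; []; _∷_)
import Data.List.Relation.Unary.AllPairs.Properties as AllPairs
open import Data.List.Relation.Unary.Any as Any using (Any)
import Data.List.Relation.Unary.Any.Properties as Any
open import Data.Nat as ℕ using (ℕ; zero; suc; _!; NonZero; s≤s; z≤n)
import Data.Nat.Properties as ℕ
open import Data.Product using (Σ; ∃; ∃₂; ∃-syntax; Σ-syntax; _×_; _,_; proj₁; proj₂; uncurry; map₂)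
open import Data.Product.Function.NonDependent.Propositional using (_×-↔_)
open import Data.Rational using (ℚ; 0ℚ; 1ℚ; _+_; _*_; -_; _/_)
open import Data.Rational.Properties
  using (toℚᵘ-injective; toℚᵘ-fromℚᵘ; toℚᵘ-homo-+; toℚᵘ-homo-*; +-identityˡ; +-identityʳ; *-assoc; *-comm;
         *-identityˡ; *-identityʳ; *-zeroˡ; *-zeroʳ; *-distribˡ-+; *-distribʳ-+)
open import Data.Rational.Solver using (module +-*-Solver)
open import Data.Rational.Unnormalised using (mkℚᵘ; *≡*)
import Data.Rational.Unnormalised.Properties as ℚᵘ
open import Data.Sum using (inj₁; inj₂)
open import Data.Sum.Function.Propositional using (_⊎-↔_)
open import Data.Vec using (lookup; tabulate)
open import Data.Vec.Properties using (lookup∘tabulate; tabulate∘lookup; tabulate-cong)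
open import Function using (_∘_; id)
open import Function.Bundles using (_⇔_; _↔_; Equivalence; Inverse; Injection; mk⇔; mk↔ₛ′)
open import Function.Properties.Inverse using (↔-refl; ↔-sym; ↔-trans; ↔⇒↣)
open import Relation.Binary using (Symmetric)
open import Relation.Binary.PropositionalEquality hiding (poset)
open import Relation.Nullary using (¬_; Dec; yes; no; contradiction)
open import Relation.Nullary.Decidable using (map′; ¬?; _×-dec_; _→-dec_)
open +-*-Solver using (solve; _:=_; _:+_; _:*_; :-_; con)

-- Power series

ι : ℕ → ℚ
ι m = ℤ.+ m / 1

ι-+ : ∀ a b → ι (a ℕ.+ b) ≡ ι a + ι b
ι-+ a b = toℚᵘ-injective (ℚᵘ.≃-trans (toℚᵘ-fromℚᵘ (mkℚᵘ (ℤ.+ (a ℕ.+ b)) 0))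
  (ℚᵘ.≃-trans (*≡* (cong (λ x → x ℤ.* ℤ.+ 1)
      (sym (cong₂ ℤ._+_ (ℤ.*-identityʳ (ℤ.+ a)) (ℤ.*-identityʳ (ℤ.+ b))))))
  (ℚᵘ.≃-sym (ℚᵘ.≃-trans (toℚᵘ-homo-+ (ι a) (ι b))
    (ℚᵘ.+-cong (toℚᵘ-fromℚᵘ (mkℚᵘ (ℤ.+ a) 0)) (toℚᵘ-fromℚᵘ (mkℚᵘ (ℤ.+ b) 0)))))))

ι-* : ∀ a b → ι (a ℕ.* b) ≡ ι a * ι b
ι-* a b = toℚᵘ-injective (ℚᵘ.≃-trans (toℚᵘ-fromℚᵘ (mkℚᵘ (ℤ.+ (a ℕ.* b)) 0))
  (ℚᵘ.≃-trans (*≡* (cong (λ x → x ℤ.* ℤ.+ 1) (ℤ.pos-* a b)))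
  (ℚᵘ.≃-sym (ℚᵘ.≃-trans (toℚᵘ-homo-* (ι a) (ι b))
    (ℚᵘ.*-cong (toℚᵘ-fromℚᵘ (mkℚᵘ (ℤ.+ a) 0)) (toℚᵘ-fromℚᵘ (mkℚᵘ (ℤ.+ b) 0)))))))

recip-* : ∀ q .{{_ : NonZero q}} → (ℤ.+ 1 / q) * ι q ≡ 1ℚ
recip-* (suc q) = toℚᵘ-injective (ℚᵘ.≃-trans (toℚᵘ-homo-* (ℤ.+ 1 / suc q) (ι (suc q)))
  (ℚᵘ.≃-trans (ℚᵘ.*-cong (toℚᵘ-fromℚᵘ (mkℚᵘ (ℤ.+ 1) q)) (toℚᵘ-fromℚᵘ (mkℚᵘ (ℤ.+ suc q) 0)))
    (*≡* (cong ℤ.+_ (begin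
      (1 ℕ.* suc q) ℕ.* 1 ≡⟨ ℕ.*-identityʳ (1 ℕ.* suc q) ⟩
      1 ℕ.* suc q         ≡⟨ cong (1 ℕ.*_) (ℕ.*-identityʳ (suc q)) ⟨
      1 ℕ.* (suc q ℕ.* 1) ∎)))))
  where open ≡-Reasoning

ι-cancel : ∀ n {x y} → ι (suc n) * x ≡ ι (suc n) * y → x ≡ y
ι-cancel n {x} {y} h = trans (sym (undo x)) (trans (cong (r *_) h) (undo y))
  where
  r = ℤ.+ 1 / suc n
  undo : ∀ z → r * (ι (suc n) * z) ≡ z
  undo z = trans (sym (*-assoc r (ι (suc n)) z))
    (trans (cong (_* z) (recip-* (suc n))) (*-identityˡ z))

invFact-! : ∀ n → invFact n * ι (n !) ≡ 1ℚ
invFact-! n = recip-* (n !) where instance _ = n ℕ.!≢0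

invFact-suc : ∀ n → ι (suc n) * invFact (suc n) ≡ invFact n
invFact-suc n = begin
  a * b                     ≡⟨ *-identityˡ (a * b) ⟨
  1ℚ * (a * b)              ≡⟨ cong (_* (a * b)) (invFact-! n) ⟨
  (c * f) * (a * b)         ≡⟨ solve 4 (λ a b c f → (c :* f) :* (a :* b) := c :* (b :* (a :* f))) refl a b c f ⟩
  c * (b * (a * f))         ≡⟨ cong (λ x → c * (b * x)) (ι-* (suc n) (n !)) ⟨
  c * (b * ι (suc n !))     ≡⟨ cong (c *_) (invFact-! (suc n)) ⟩
  c * 1ℚ                    ≡⟨ *-identityʳ c ⟩
  c                         ∎
  where
  open ≡-Reasoning
  a = ι (suc n)
  b = invFact (suc n)
  c = invFact n
  f = ι (n !)

-- Finite sums

∑ : ℕ → (ℕ → ℚ) → ℚ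
∑ m f = sumℚ (applyUpTo f m)

∑-cong : ∀ m {f g : ℕ → ℚ} → (∀ i → i ℕ.< m → f i ≡ g i) → ∑ m f ≡ ∑ m g
∑-cong zero    h = refl
∑-cong (suc m) h = cong₂ _+_ (h 0 (s≤s z≤n)) (∑-cong m (λ i i<m → h (suc i) (s≤s i<m)))

∑-0 : ∀ m → ∑ m (λ _ → 0ℚ) ≡ 0ℚ
∑-0 zero    = refl
∑-0 (suc m) = trans (+-identityˡ _) (∑-0 m)

∑-+ : ∀ m f g → ∑ m (λ i → f i + g i) ≡ ∑ m f + ∑ m g
∑-+ zero    f g = refl
∑-+ (suc m) f g = trans (cong ((f 0 + g 0) +_) (∑-+ m (f ∘ suc) (g ∘ suc)))
  (solve 4 (λ a b c d → (a :+ b) :+ (c :+ d) := (a :+ c) :+ (b :+ d)) refl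
    (f 0) (g 0) (∑ m (f ∘ suc)) (∑ m (g ∘ suc)))

∑-*ˡ : ∀ m c f → ∑ m (λ i → c * f i) ≡ c * ∑ m f
∑-*ˡ zero    c f = sym (*-zeroʳ c)
∑-*ˡ (suc m) c f = trans (cong (c * f 0 +_) (∑-*ˡ m c (f ∘ suc))) (sym (*-distribˡ-+ c (f 0) _))

∑-swap : ∀ m n (f : ℕ → ℕ → ℚ) → ∑ m (λ i → ∑ n (f i)) ≡ ∑ n (λ j → ∑ m (λ i → f i j))
∑-swap zero    n f = sym (∑-0 n)
∑-swap (suc m) n f = trans (cong (∑ n (f 0) +_) (∑-swap m n (f ∘ suc)))
  (sym (∑-+ n (f 0) (λ j → ∑ m (λ i → f (suc i) j))))

-- The algebra of power series

infixl 6 _⊕_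
infixr 7 _⊙_

_⊕_ : PS → PS → PS
(f ⊕ g) n = f n + g n

_⊙_ : ℚ → PS → PS
(c ⊙ f) n = c * f n

𝟘 𝟙 : PS
𝟘 _ = 0ℚ
𝟙 zero    = 1ℚ
𝟙 (suc _) = 0ℚ

·-zero : ∀ f g → (f · g) 0 ≡ f 0 * g 0
·-zero f g = +-identityʳ (f 0 * g 0)

-- Splitting off the constant term of the left factor turns the convolution into a recursion on the
-- degree. The laws below follow by induction along it, with the left factor shifted.
·-suc : ∀ f g n → (f · g) (suc n) ≡ f 0 * g (suc n) + ((f ∘ suc) · g) n
·-suc f g n = trans (cong sumℚ (map-upTo (λ k → f k * g (suc n ℕ.∸ k)) (suc (suc n))))
  (cong (λ l → f 0 * g (suc n) + sumℚ l)
    (sym (map-upTo (λ k → f (suc k) * g (n ℕ.∸ k)) (suc n))))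

·-congˡ : ∀ {f f′} g n → (∀ i → f i ≡ f′ i) → (f · g) n ≡ (f′ · g) n
·-congˡ {f} {f′} g zero    h = cong (λ x → x * g 0 + 0ℚ) (h 0)
·-congˡ {f} {f′} g (suc n) h = trans (·-suc f g n) (trans
  (cong₂ _+_ (cong (_* g (suc n)) (h 0)) (·-congˡ g n (h ∘ suc)))
  (sym (·-suc f′ g n)))

·-congʳ≤ : ∀ f {g g′} n → (∀ i → i ℕ.≤ n → g i ≡ g′ i) → (f · g) n ≡ (f · g′) n
·-congʳ≤ f zero    h = cong (λ x → f 0 * x + 0ℚ) (h 0 z≤n)
·-congʳ≤ f {g} {g′} (suc n) h = trans (·-suc f g n) (trans
  (cong₂ _+_ (cong (f 0 *_) (h (suc n) ℕ.≤-refl))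
    (·-congʳ≤ (f ∘ suc) n (λ i i≤n → h i (ℕ.m≤n⇒m≤1+n i≤n))))
  (sym (·-suc f g′ n)))

·-congʳ : ∀ f {g g′} n → (∀ i → g i ≡ g′ i) → (f · g) n ≡ (f · g′) n
·-congʳ f n h = ·-congʳ≤ f n (λ i _ → h i)

-- Multiplication by a series without constant term raises degrees, so coefficient `n` sees `g` only
-- below `n`. This strictness makes the self-reference in `∑-cmp-pow` well-founded.
·-congʳ< : ∀ f {g g′} n → f 0 ≡ 0ℚ → (∀ i → i ℕ.< n → g i ≡ g′ i) → (f · g) n ≡ (f · g′) n
·-congʳ< f {g} {g′} zero f0 h = trans (·-zero f g) (trans (vanish (g 0)) (sym (trans (·-zero f g′) (vanish (g′ 0)))))
  where
  vanish : ∀ x → f 0 * x ≡ 0ℚ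
  vanish x = trans (cong (_* x) f0) (*-zeroˡ x)
·-congʳ< f {g} {g′} (suc n) f0 h = trans (·-suc f g n) (trans
  (cong₂ _+_ (trans (vanish (g (suc n))) (sym (vanish (g′ (suc n)))))
    (·-congʳ≤ (f ∘ suc) n (λ i i≤n → h i (s≤s i≤n))))
  (sym (·-suc f g′ n)))
  where
  vanish : ∀ x → f 0 * x ≡ 0ℚ
  vanish x = trans (cong (_* x) f0) (*-zeroˡ x)

·-distribˡ : ∀ f g h n → (f · (g ⊕ h)) n ≡ (f · g) n + (f · h) n
·-distribˡ f g h zero = solve 3 (λ f g h → f :* (g :+ h) :+ con 0ℚ := (f :* g :+ con 0ℚ) :+ (f :* h :+ con 0ℚ))
  refl (f 0) (g 0) (h 0)
·-distribˡ f g h (suc n)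
  rewrite ·-suc f (g ⊕ h) n | ·-suc f g n | ·-suc f h n | ·-distribˡ (f ∘ suc) g h n
  = solve 5 (λ f g h a b → f :* (g :+ h) :+ (a :+ b) := (f :* g :+ a) :+ (f :* h :+ b))
    refl (f 0) (g (suc n)) (h (suc n)) (((f ∘ suc) · g) n) (((f ∘ suc) · h) n)

·-distribʳ : ∀ f g h n → ((f ⊕ g) · h) n ≡ (f · h) n + (g · h) n
·-distribʳ f g h zero = solve 3 (λ f g h → (f :+ g) :* h :+ con 0ℚ := (f :* h :+ con 0ℚ) :+ (g :* h :+ con 0ℚ))
  refl (f 0) (g 0) (h 0)
·-distribʳ f g h (suc n)
  rewrite ·-suc (f ⊕ g) h n | ·-suc f h n | ·-suc g h n | ·-distribʳ (f ∘ suc) (g ∘ suc) h n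
  = solve 5 (λ f g h a b → (f :+ g) :* h :+ (a :+ b) := (f :* h :+ a) :+ (g :* h :+ b))
    refl (f 0) (g 0) (h (suc n)) (((f ∘ suc) · h) n) (((g ∘ suc) · h) n)

·-scaleˡ : ∀ c f g n → ((c ⊙ f) · g) n ≡ c * (f · g) n
·-scaleˡ c f g zero = solve 3 (λ c f g → c :* f :* g :+ con 0ℚ := c :* (f :* g :+ con 0ℚ)) refl c (f 0) (g 0)
·-scaleˡ c f g (suc n)
  rewrite ·-suc (c ⊙ f) g n | ·-suc f g n | ·-scaleˡ c (f ∘ suc) g n
  = solve 4 (λ c f g a → c :* f :* g :+ c :* a := c :* (f :* g :+ a)) refl c (f 0) (g (suc n)) (((f ∘ suc) · g) n)

·-scaleʳ : ∀ c f g n → (f · (c ⊙ g)) n ≡ c * (f · g) n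
·-scaleʳ c f g zero = solve 3 (λ c f g → f :* (c :* g) :+ con 0ℚ := c :* (f :* g :+ con 0ℚ)) refl c (f 0) (g 0)
·-scaleʳ c f g (suc n)
  rewrite ·-suc f (c ⊙ g) n | ·-suc f g n | ·-scaleʳ c (f ∘ suc) g n
  = solve 4 (λ c f g a → f :* (c :* g) :+ c :* a := c :* (f :* g :+ a)) refl c (f 0) (g (suc n)) (((f ∘ suc) · g) n)

·-𝟘ˡ : ∀ f n → (𝟘 · f) n ≡ 0ℚ
·-𝟘ˡ f zero    = trans (·-zero 𝟘 f) (*-zeroˡ (f 0))
·-𝟘ˡ f (suc n) = trans (·-suc 𝟘 f n) (cong₂ _+_ (*-zeroˡ (f (suc n))) (·-𝟘ˡ f n))

·-𝟘ʳ : ∀ f n → (f · 𝟘) n ≡ 0ℚ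
·-𝟘ʳ f zero    = trans (·-zero f 𝟘) (*-zeroʳ (f 0))
·-𝟘ʳ f (suc n) = trans (·-suc f 𝟘 n) (cong₂ _+_ (*-zeroʳ (f 0)) (·-𝟘ʳ (f ∘ suc) n))

·-identityˡ : ∀ f n → (𝟙 · f) n ≡ f n
·-identityˡ f zero    = trans (·-zero 𝟙 f) (*-identityˡ (f 0))
·-identityˡ f (suc n) = trans (·-suc 𝟙 f n)
  (trans (cong₂ _+_ (*-identityˡ (f (suc n))) (·-𝟘ˡ f n)) (+-identityʳ (f (suc n))))

·-identityʳ : ∀ f n → (f · 𝟙) n ≡ f n
·-identityʳ f zero    = trans (·-zero f 𝟙) (*-identityʳ (f 0))
·-identityʳ f (suc n) = trans (·-suc f 𝟙 n)
  (trans (cong₂ _+_ (*-zeroʳ (f 0)) (·-identityʳ (f ∘ suc) n)) (+-identityˡ (f (suc n))))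

·-assoc : ∀ f g h n → ((f · g) · h) n ≡ (f · (g · h)) n
·-assoc f g h zero = solve 3 (λ f g h → (f :* g :+ con 0ℚ) :* h :+ con 0ℚ := f :* (g :* h :+ con 0ℚ) :+ con 0ℚ)
  refl (f 0) (g 0) (h 0)
·-assoc f g h (suc n) = begin
  ((f · g) · h) (suc n)
    ≡⟨ ·-suc (f · g) h n ⟩
  (f · g) 0 * h (suc n) + (((f · g) ∘ suc) · h) n
    ≡⟨ cong₂ _+_ (cong (_* h (suc n)) (·-zero f g)) (·-congˡ h n (·-suc f g)) ⟩
  f 0 * g 0 * h (suc n) + ((f 0 ⊙ (g ∘ suc) ⊕ ((f ∘ suc) · g)) · h) n
    ≡⟨ cong (f 0 * g 0 * h (suc n) +_) (trans (·-distribʳ (f 0 ⊙ (g ∘ suc)) ((f ∘ suc) · g) h n)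
         (cong₂ _+_ (·-scaleˡ (f 0) (g ∘ suc) h n) (·-assoc (f ∘ suc) g h n))) ⟩
  f 0 * g 0 * h (suc n) + (f 0 * ((g ∘ suc) · h) n + ((f ∘ suc) · (g · h)) n)
    ≡⟨ solve 5 (λ f g h a b → f :* g :* h :+ (f :* a :+ b) := f :* (g :* h :+ a) :+ b) refl
         (f 0) (g 0) (h (suc n)) (((g ∘ suc) · h) n) (((f ∘ suc) · (g · h)) n) ⟩
  f 0 * (g 0 * h (suc n) + ((g ∘ suc) · h) n) + ((f ∘ suc) · (g · h)) n
    ≡⟨ cong (λ x → f 0 * x + ((f ∘ suc) · (g · h)) n) (·-suc g h n) ⟨
  f 0 * (g · h) (suc n) + ((f ∘ suc) · (g · h)) n
    ≡⟨ ·-suc f (g · h) n ⟨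
  (f · (g · h)) (suc n) ∎
  where open ≡-Reasoning

·-∑ : ∀ f M (a : ℕ → ℚ) (p : ℕ → PS) n →
      (f · (λ i → ∑ M (λ j → a j * p j i))) n ≡ ∑ M (λ j → a j * (f · p j) n)
·-∑ f zero    a p n = ·-𝟘ʳ f n
·-∑ f (suc M) a p n = trans
  (·-distribˡ f (a 0 ⊙ p 0) (λ i → ∑ M (λ j → a (suc j) * p (suc j) i)) n)
  (cong₂ _+_ (·-scaleʳ (a 0) f (p 0) n) (·-∑ f M (a ∘ suc) (p ∘ suc) n))

-- Formal derivatives

D : PS → PS
D f n = ι (suc n) * f (suc n)

-- The Leibniz rule, by induction on the degree. The weight of a coefficient exceeds its weight in
-- the shifted series by one; this leaves an extra undifferentiated product, which `tail-D`
-- reabsorbs.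
D-· : ∀ f g n → D (f · g) n ≡ (D f · g) n + (f · D g) n
D-· f g zero
  rewrite ·-suc f g 0
  = solve 4 (λ f0 f1 g0 g1 → con (ι 1) :* (f0 :* g1 :+ (f1 :* g0 :+ con 0ℚ))
      := (con (ι 1) :* f1 :* g0 :+ con 0ℚ) :+ (f0 :* (con (ι 1) :* g1) :+ con 0ℚ))
    refl (f 0) (f 1) (g 0) (g 1)
D-· f g (suc n) = begin
  ι (2 ℕ.+ n) * (f · g) (2 ℕ.+ n)
    ≡⟨ cong (ι (2 ℕ.+ n) *_) (·-suc f g (suc n)) ⟩
  ι (2 ℕ.+ n) * (f 0 * g (2 ℕ.+ n) + (tf · g) (suc n))
    ≡⟨ *-distribˡ-+ (ι (2 ℕ.+ n)) (f 0 * g (2 ℕ.+ n)) ((tf · g) (suc n)) ⟩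
  ι (2 ℕ.+ n) * (f 0 * g (2 ℕ.+ n)) + ι (2 ℕ.+ n) * (tf · g) (suc n)
    ≡⟨ cong (λ x → ι (2 ℕ.+ n) * (f 0 * g (2 ℕ.+ n)) + x * (tf · g) (suc n)) (ι-+ 1 (suc n)) ⟩
  ι (2 ℕ.+ n) * (f 0 * g (2 ℕ.+ n)) + (1ℚ + ι (suc n)) * (tf · g) (suc n)
    ≡⟨ solve 5 (λ a b c d e → a :* (b :* c) :+ (con 1ℚ :+ d) :* e := b :* (a :* c) :+ (e :+ d :* e)) refl
         (ι (2 ℕ.+ n)) (f 0) (g (2 ℕ.+ n)) (ι (suc n)) ((tf · g) (suc n)) ⟩
  f 0 * D g (suc n) + ((tf · g) (suc n) + D (tf · g) n)
    ≡⟨ cong₂ (λ x y → f 0 * D g (suc n) + (x + y)) (·-suc tf g n) (D-· tf g n) ⟩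
  f 0 * D g (suc n) + ((f 1 * g (suc n) + (ttf · g) n) + ((D tf · g) n + (tf · D g) n))
    ≡⟨ solve 5 (λ a b c d e → a :+ ((b :+ c) :+ (d :+ e)) := (con (ι 1) :* b :+ (c :+ d)) :+ (a :+ e)) refl
         (f 0 * D g (suc n)) (f 1 * g (suc n)) ((ttf · g) n) ((D tf · g) n) ((tf · D g) n) ⟩
  (ι 1 * (f 1 * g (suc n)) + ((ttf · g) n + (D tf · g) n)) + (f 0 * D g (suc n) + (tf · D g) n)
    ≡⟨ cong₂ _+_ (cong₂ _+_ (*-assoc (ι 1) (f 1) (g (suc n))) (·-distribʳ ttf (D tf) g n)) (·-suc f (D g) n) ⟨
  (D f 0 * g (suc n) + ((ttf ⊕ D tf) · g) n) + (f · D g) (suc n)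
    ≡⟨ cong (λ x → (D f 0 * g (suc n) + x) + (f · D g) (suc n)) (·-congˡ g n tail-D) ⟨
  (D f 0 * g (suc n) + ((D f ∘ suc) · g) n) + (f · D g) (suc n)
    ≡⟨ cong (_+ (f · D g) (suc n)) (·-suc (D f) g n) ⟨
  (D f · g) (suc n) + (f · D g) (suc n) ∎
  where
  open ≡-Reasoning
  tf = f ∘ suc
  ttf = tf ∘ suc
  tail-D : ∀ i → D f (suc i) ≡ (ttf ⊕ D tf) i
  tail-D i = trans (cong (_* f (2 ℕ.+ i)) (ι-+ 1 (suc i)))
    (solve 2 (λ a b → (con 1ℚ :+ a) :* b := b :+ a :* b) refl (ι (suc i)) (f (2 ℕ.+ i)))

D-injective : ∀ {f g} → f 0 ≡ g 0 → (∀ n → D f n ≡ D g n) → ∀ n → f n ≡ g n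
D-injective h0 h zero    = h0
D-injective h0 h (suc n) = ι-cancel n (h n)

D-expm1 : ∀ n → D expm1 n ≡ (𝟙 ⊕ expm1) n
D-expm1 zero    = refl
D-expm1 (suc n) = trans (invFact-suc (suc n)) (sym (+-identityˡ (invFact (suc n))))

D-oneMinusExpNeg : ∀ n → D oneMinusExpNeg n ≡ (𝟙 ⊕ (- 1ℚ) ⊙ oneMinusExpNeg) n
D-oneMinusExpNeg zero    = refl
D-oneMinusExpNeg (suc n) = begin
  a * (- s * b)                     ≡⟨ solve 3 (λ a s b → a :* (:- s :* b) := :- s :* (a :* b)) refl a s b ⟩
  - s * (a * b)                     ≡⟨ cong (- s *_) (invFact-suc (suc n)) ⟩
  - s * invFact (suc n)             ≡⟨ solve 2 (λ s i → :- s :* i := con 0ℚ :+ (:- con 1ℚ) :* (s :* i)) refl s (invFact (suc n)) ⟩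
  0ℚ + - 1ℚ * (s * invFact (suc n)) ∎
  where
  open ≡-Reasoning
  a = ι (2 ℕ.+ n)
  s = sign n
  b = invFact (2 ℕ.+ n)

-- Powers of eˣ - 1 and of x/(1 - x)

pow-zero : ∀ f n → pow f 0 n ≡ 𝟙 n
pow-zero f zero    = refl
pow-zero f (suc n) = refl

-- This is (k+1) vᵏ v′ with v′ = 1 + v, where v = eˣ - 1.
D-pow-expm1 : ∀ k n → D (pow expm1 (suc k)) n ≡ ι (suc k) * (pow expm1 k n + pow expm1 (suc k) n)
D-pow-expm1 k n = begin
  D (v · pow v k) n
    ≡⟨ D-· v (pow v k) n ⟩
  (D v · pow v k) n + (v · D (pow v k)) n
    ≡⟨ cong₂ _+_ (trans (·-congˡ (pow v k) n D-expm1) (trans (·-distribʳ 𝟙 v (pow v k) n)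
         (cong (_+ pow v (suc k) n) (·-identityˡ (pow v k) n)))) (v·D k) ⟩
  (pow v k n + pow v (suc k) n) + ι k * (pow v k n + pow v (suc k) n)
    ≡⟨ solve 2 (λ x y → x :+ y :* x := (con 1ℚ :+ y) :* x) refl (pow v k n + pow v (suc k) n) (ι k) ⟩
  (1ℚ + ι k) * (pow v k n + pow v (suc k) n)
    ≡⟨ cong (_* (pow v k n + pow v (suc k) n)) (ι-+ 1 k) ⟨
  ι (suc k) * (pow v k n + pow v (suc k) n) ∎
  where
  open ≡-Reasoning
  v = expm1
  -- Multiplying by v restores the power lost in differentiation, so this form also covers exponent
  -- 0. The two statements recurse on each other.
  v·D : ∀ k → (v · D (pow v k)) n ≡ ι k * (pow v k n + pow v (suc k) n)
  v·D zero    = trans (·-congʳ v n (λ i → *-zeroʳ (ι (suc i))))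
    (trans (·-𝟘ʳ v n) (sym (*-zeroˡ (pow v 0 n + pow v 1 n))))
  v·D (suc k) = trans (·-congʳ v n (D-pow-expm1 k))
    (trans (·-scaleʳ (ι (suc k)) v (pow v k ⊕ pow v (suc k)) n)
      (cong (ι (suc k) *_) (·-distribˡ v (pow v k) (pow v (suc k)) n)))

-- Stirling numbers of the second kind; the two summands match `new` and `old` of `RGS`.
S2 : ℕ → ℕ → ℕ
S2 zero    zero    = 1
S2 zero    (suc k) = 0
S2 (suc n) zero    = 0
S2 (suc n) (suc k) = S2 n k ℕ.+ suc k ℕ.* S2 n (suc k)

-- In degree `n` the derivative rule reads (k+1)(k! S₂(n,k) + (k+1)! S₂(n,k+1))/n!, and pulling out
-- (k+1)! leaves the recurrence of `S2`.
pow-expm1 : ∀ n k → pow expm1 k n ≡ ι (S2 n k) * ι (k !) * invFact n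
pow-expm1 zero zero       = refl
pow-expm1 zero (suc k)    = trans (trans (·-zero expm1 (pow expm1 k)) (*-zeroˡ (pow expm1 k 0)))
  (sym (trans (cong (_* invFact 0) (*-zeroˡ (ι (suc k !)))) (*-zeroˡ (invFact 0))))
pow-expm1 (suc n) zero    = sym (trans (cong (_* invFact (suc n)) (*-zeroˡ (ι 1))) (*-zeroˡ (invFact (suc n))))
pow-expm1 (suc n) (suc k) = ι-cancel n (begin
  D (pow expm1 (suc k)) n
    ≡⟨ D-pow-expm1 k n ⟩
  c * (pow expm1 k n + pow expm1 (suc k) n)
    ≡⟨ cong (c *_) (cong₂ _+_ (pow-expm1 n k) (pow-expm1 n (suc k))) ⟩
  c * (ι (S2 n k) * ι (k !) * invFact n + ι (S2 n (suc k)) * ι (suc k !) * invFact n)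
    ≡⟨ cong₂ (λ x y → c * (ι (S2 n k) * ι (k !) * x + ι (S2 n (suc k)) * y * x)) (sym (invFact-suc n)) (ι-* (suc k) (k !)) ⟩
  c * (ι (S2 n k) * ι (k !) * (m * i) + ι (S2 n (suc k)) * (c * ι (k !)) * (m * i))
    ≡⟨ solve 6 (λ c a b f m i → c :* (a :* f :* (m :* i) :+ b :* (c :* f) :* (m :* i))
                              := m :* ((a :+ c :* b) :* (c :* f) :* i)) refl
         c (ι (S2 n k)) (ι (S2 n (suc k))) (ι (k !)) m i ⟩
  m * ((ι (S2 n k) + c * ι (S2 n (suc k))) * (c * ι (k !)) * i)
    ≡⟨ cong₂ (λ x y → m * (x * y * i))
         (trans (cong (λ x → ι (S2 n k) + x) (sym (ι-* (suc k) (S2 n (suc k))))) (sym (ι-+ (S2 n k) (suc k ℕ.* S2 n (suc k)))))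
         (sym (ι-* (suc k) (k !))) ⟩
  m * (ι (S2 (suc n) (suc k)) * ι (suc k !) * i) ∎)
  where
  open ≡-Reasoning
  c = ι (suc k)
  m = ι (suc n)
  i = invFact (suc n)

-- Compositions of `n` into `k` positive parts: a first part equal to 1 is removed, a larger one is
-- decreased by 1.
cmp : ℕ → ℕ → ℕ
cmp zero    zero    = 1
cmp zero    (suc k) = 0
cmp (suc n) zero    = 0
cmp (suc n) (suc k) = cmp n k ℕ.+ cmp n (suc k)

pow-geomx : ∀ k n → pow geomx k n ≡ ι (cmp n k)
pow-geomx zero    zero    = refl
pow-geomx zero    (suc n) = refl
pow-geomx (suc k) zero    = trans (·-zero geomx (pow geomx k)) (*-zeroˡ (pow geomx k 0))
pow-geomx (suc k) (suc n) = trans (·-suc geomx (pow geomx k) n)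
  (trans (cong (_+ (1s · pow geomx k) n) (*-zeroˡ (pow geomx k (suc n))))
  (trans (+-identityˡ ((1s · pow geomx k) n)) (partial n)))
  where
  1s : PS
  1s _ = 1ℚ
  -- Dropping the leading x from x/(1 - x) leaves 1/(1 - x), and multiplying by that takes partial
  -- sums. Unrolling the recurrence of `cmp` gives the same sums.
  partial : ∀ n → (1s · pow geomx k) n ≡ ι (cmp (suc n) (suc k))
  partial zero    = trans (·-zero 1s (pow geomx k)) (trans (*-identityˡ (pow geomx k 0))
    (trans (pow-geomx k 0) (cong ι (sym (ℕ.+-identityʳ (cmp 0 k))))))
  partial (suc n) = trans (·-suc 1s (pow geomx k) n)
    (trans (cong₂ _+_ (trans (*-identityˡ (pow geomx k (suc n))) (pow-geomx k (suc n))) (partial n))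
      (sym (ι-+ (cmp (suc n) k) (cmp (suc n) (suc k)))))

-- (eˣ − 1)e⁻ˣ = 1 − e⁻ˣ, written without subtraction: this is v = u/(1 − u).
expm1-unfold : ∀ n → expm1 n ≡ (oneMinusExpNeg ⊕ (oneMinusExpNeg · expm1)) n
expm1-unfold = D-injective refl (λ n → sym (begin
  ι (suc n) * (u (suc n) + (u · v) (suc n))
    ≡⟨ *-distribˡ-+ (ι (suc n)) (u (suc n)) ((u · v) (suc n)) ⟩
  D u n + D (u · v) n
    ≡⟨ cong (D u n +_) (D-· u v n) ⟩
  D u n + ((D u · v) n + (u · D v) n)
    ≡⟨ cong₂ (λ x y → x + y) (D-oneMinusExpNeg n) (cong₂ _+_
         (trans (·-congˡ v n D-oneMinusExpNeg) (trans (·-distribʳ 𝟙 ((- 1ℚ) ⊙ u) v n)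
           (cong₂ _+_ (·-identityˡ v n) (·-scaleˡ (- 1ℚ) u v n))))
         (trans (·-congʳ u n D-expm1) (trans (·-distribˡ u 𝟙 v n) (cong (_+ (u · v) n) (·-identityʳ u n))))) ⟩
  (𝟙 n + - 1ℚ * u n) + ((v n + - 1ℚ * (u · v) n) + (u n + (u · v) n))
    ≡⟨ solve 4 (λ o u v w → (o :+ (:- con 1ℚ) :* u) :+ ((v :+ (:- con 1ℚ) :* w) :+ (u :+ w)) := o :+ v) refl
         (𝟙 n) (u n) (v n) ((u · v) n) ⟩
  𝟙 n + v n
    ≡⟨ D-expm1 n ⟨
  D v n ∎))
  where
  open ≡-Reasoning
  u = oneMinusExpNeg
  v = expm1

-- Both sides satisfy F(k+1) = u F(k) + u F(k+1): the sum by the recurrence of `cmp`, the power of v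
-- by v = u + uv. The F(k+1) on the right is read only below degree `n`. The bound is any `M` above
-- `n` because shifting the index shortens the sum by one term.
∑-cmp-pow : ∀ M n → n ℕ.< M → ∀ k →
            ∑ M (λ j → ι (cmp j k) * pow oneMinusExpNeg j n) ≡ pow expm1 k n
∑-cmp-pow (suc M) n _ zero = trans
  (cong₂ _+_ (*-identityˡ (pow u 0 n)) (trans (∑-cong M (λ j _ → *-zeroˡ (pow u (suc j) n))) (∑-0 M)))
  (trans (+-identityʳ (pow u 0 n)) (trans (pow-zero u n) (sym (pow-zero expm1 n))))
  where u = oneMinusExpNeg
∑-cmp-pow (suc M) n (s≤s n≤M) (suc k) = begin
  0ℚ * pow u 0 n + ∑ M (λ j → ι (cmp (suc j) (suc k)) * (u · pow u j) n)
    ≡⟨ cong (_+ rest) (*-zeroˡ (pow u 0 n)) ⟩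
  0ℚ + ∑ M (λ j → ι (cmp (suc j) (suc k)) * (u · pow u j) n)
    ≡⟨ +-identityˡ rest ⟩
  ∑ M (λ j → ι (cmp j k ℕ.+ cmp j (suc k)) * (u · pow u j) n)
    ≡⟨ ∑-cong M (λ j _ → trans (cong (_* (u · pow u j) n) (ι-+ (cmp j k) (cmp j (suc k))))
         (*-distribʳ-+ ((u · pow u j) n) (ι (cmp j k)) (ι (cmp j (suc k))))) ⟩
  ∑ M (λ j → ι (cmp j k) * (u · pow u j) n + ι (cmp j (suc k)) * (u · pow u j) n)
    ≡⟨ ∑-+ M _ _ ⟩
  ∑ M (λ j → ι (cmp j k) * (u · pow u j) n) + ∑ M (λ j → ι (cmp j (suc k)) * (u · pow u j) n)
    ≡⟨ cong₂ _+_ (step k) (step (suc k)) ⟩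
  (u · pow v k) n + (u · (v · pow v k)) n
    ≡⟨ cong ((u · pow v k) n +_) (·-assoc u v (pow v k) n) ⟨
  (u · pow v k) n + ((u · v) · pow v k) n
    ≡⟨ ·-distribʳ u (u · v) (pow v k) n ⟨
  ((u ⊕ (u · v)) · pow v k) n
    ≡⟨ ·-congˡ (pow v k) n expm1-unfold ⟨
  pow v (suc k) n ∎
  where
  open ≡-Reasoning
  u = oneMinusExpNeg
  v = expm1
  rest = ∑ M (λ j → ι (cmp (suc j) (suc k)) * (u · pow u j) n)
  step : ∀ k → ∑ M (λ j → ι (cmp j k) * (u · pow u j) n) ≡ (u · pow v k) n
  step k = trans (sym (·-∑ u M (λ j → ι (cmp j k)) (pow u) n))
    (·-congʳ< u n refl (λ i i<n → ∑-cmp-pow M i (ℕ.<-≤-trans i<n n≤M) k))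

-- From counting formulas to series identities

sumℕ : ℕ → (ℕ → ℕ) → ℕ
sumℕ zero    a = 0
sumℕ (suc m) a = a 0 ℕ.+ sumℕ m (a ∘ suc)

ι-sumℕ : ∀ m a → ι (sumℕ m a) ≡ ∑ m (ι ∘ a)
ι-sumℕ zero    a = refl
ι-sumℕ (suc m) a = trans (ι-+ (a 0) (sumℕ m (a ∘ suc))) (cong (λ x → ι (a 0) + x) (ι-sumℕ m (a ∘ suc)))

∘ₚ-∑ : ∀ f g n → (f ∘ₚ g) n ≡ ∑ (suc n) (λ k → f k * pow g k n)
∘ₚ-∑ f g n = cong sumℚ (map-upTo (λ k → f k * pow g k n) (suc n))

module _ (o e s t : ℕ → ℕ)
  (s≡ : ∀ k → s k ≡ k ! ℕ.* t k)
  (e≡ : ∀ n → e n ≡ sumℕ (suc n) (λ k → s k ℕ.* S2 n k))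
  (o≡ : ∀ m n → n ℕ.< m → o n ≡ sumℕ m (λ k → t k ℕ.* cmp n k)) where

  open ≡-Reasoning

  -- The factor k! cancels the denominator, so S(x) is the ordinary generating function of `t`.
  egf-s : ∀ k → egf s k ≡ ι (t k)
  egf-s k = begin
    ι (s k) * invFact k           ≡⟨ cong (λ x → ι x * invFact k) (s≡ k) ⟩
    ι (k ! ℕ.* t k) * invFact k   ≡⟨ cong (_* invFact k) (ι-* (k !) (t k)) ⟩
    ι (k !) * ι (t k) * invFact k ≡⟨ solve 3 (λ a b c → a :* b :* c := (c :* a) :* b) refl (ι (k !)) (ι (t k)) (invFact k) ⟩
    (invFact k * ι (k !)) * ι (t k) ≡⟨ cong (_* ι (t k)) (invFact-! k) ⟩
    1ℚ * ι (t k)                  ≡⟨ *-identityˡ (ι (t k)) ⟩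
    ι (t k)                       ∎

  egf-∘-expm1 : ∀ n → egf e n ≡ (egf s ∘ₚ expm1) n
  egf-∘-expm1 n = begin
    ι (e n) * invFact n
      ≡⟨ cong (_* invFact n) (trans (cong ι (e≡ n)) (ι-sumℕ (suc n) (λ k → s k ℕ.* S2 n k))) ⟩
    ∑ (suc n) (λ k → ι (s k ℕ.* S2 n k)) * invFact n
      ≡⟨ trans (*-comm (∑ (suc n) (λ k → ι (s k ℕ.* S2 n k))) (invFact n))
           (sym (∑-*ˡ (suc n) (invFact n) (λ k → ι (s k ℕ.* S2 n k)))) ⟩
    ∑ (suc n) (λ k → invFact n * ι (s k ℕ.* S2 n k))
      ≡⟨ ∑-cong (suc n) (λ k _ → term k) ⟩
    ∑ (suc n) (λ k → egf s k * pow expm1 k n)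
      ≡⟨ ∘ₚ-∑ (egf s) expm1 n ⟨
    (egf s ∘ₚ expm1) n ∎
    where
    term : ∀ k → invFact n * ι (s k ℕ.* S2 n k) ≡ egf s k * pow expm1 k n
    term k = begin
      invFact n * ι (s k ℕ.* S2 n k)
        ≡⟨ cong (invFact n *_) (ι-* (s k) (S2 n k)) ⟩
      invFact n * (ι (s k) * ι (S2 n k))
        ≡⟨ *-identityˡ _ ⟨
      1ℚ * (invFact n * (ι (s k) * ι (S2 n k)))
        ≡⟨ cong (_* (invFact n * (ι (s k) * ι (S2 n k)))) (invFact-! k) ⟨
      (invFact k * ι (k !)) * (invFact n * (ι (s k) * ι (S2 n k)))
        ≡⟨ solve 5 (λ a b c d e → (a :* b) :* (c :* (d :* e)) := (d :* a) :* (e :* b :* c)) refl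
             (invFact k) (ι (k !)) (invFact n) (ι (s k)) (ι (S2 n k)) ⟩
      (ι (s k) * invFact k) * (ι (S2 n k) * ι (k !) * invFact n)
        ≡⟨ cong (egf s k *_) (pow-expm1 n k) ⟨
      egf s k * pow expm1 k n ∎

  ogf-∘-geomx : ∀ n → ogf o n ≡ (egf s ∘ₚ geomx) n
  ogf-∘-geomx n = begin
    ι (o n)
      ≡⟨ trans (cong ι (o≡ (suc n) n (ℕ.n<1+n n))) (ι-sumℕ (suc n) (λ k → t k ℕ.* cmp n k)) ⟩
    ∑ (suc n) (λ k → ι (t k ℕ.* cmp n k))
      ≡⟨ ∑-cong (suc n) (λ k _ → trans (ι-* (t k) (cmp n k)) (sym (cong₂ _*_ (egf-s k) (pow-geomx k n)))) ⟩
    ∑ (suc n) (λ k → egf s k * pow geomx k n)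
      ≡⟨ ∘ₚ-∑ (egf s) geomx n ⟨
    (egf s ∘ₚ geomx) n ∎

  -- After the double sum is swapped, `∑-cmp-pow` evaluates the inner sums. The swap uses one range
  -- for all j, which is why `o≡` admits every bound `m` above its index.
  egf-∘-oneMinusExpNeg : ∀ n → egf e n ≡ (ogf o ∘ₚ oneMinusExpNeg) n
  egf-∘-oneMinusExpNeg n = sym (begin
    (ogf o ∘ₚ oneMinusExpNeg) n
      ≡⟨ ∘ₚ-∑ (ogf o) oneMinusExpNeg n ⟩
    ∑ (suc n) (λ j → ι (o j) * u j)
      ≡⟨ ∑-cong (suc n) (λ j j<m → begin
           ι (o j) * u j
             ≡⟨ cong (_* u j) (trans (cong ι (o≡ (suc n) j j<m)) (ι-sumℕ (suc n) (λ k → t k ℕ.* cmp j k))) ⟩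
           ∑ (suc n) (λ k → ι (t k ℕ.* cmp j k)) * u j
             ≡⟨ trans (*-comm (∑ (suc n) (λ k → ι (t k ℕ.* cmp j k))) (u j))
                  (sym (∑-*ˡ (suc n) (u j) (λ k → ι (t k ℕ.* cmp j k)))) ⟩
           ∑ (suc n) (λ k → u j * ι (t k ℕ.* cmp j k))
             ≡⟨ ∑-cong (suc n) (λ k _ → trans (cong (u j *_) (ι-* (t k) (cmp j k)))
                  (solve 3 (λ a b c → a :* (b :* c) := b :* (c :* a)) refl (u j) (ι (t k)) (ι (cmp j k)))) ⟩
           ∑ (suc n) (λ k → ι (t k) * (ι (cmp j k) * u j)) ∎) ⟩
    ∑ (suc n) (λ j → ∑ (suc n) (λ k → ι (t k) * (ι (cmp j k) * u j)))
      ≡⟨ ∑-swap (suc n) (suc n) (λ j k → ι (t k) * (ι (cmp j k) * u j)) ⟩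
    ∑ (suc n) (λ k → ∑ (suc n) (λ j → ι (t k) * (ι (cmp j k) * u j)))
      ≡⟨ ∑-cong (suc n) (λ k _ → trans (∑-*ˡ (suc n) (ι (t k)) (λ j → ι (cmp j k) * u j))
           (cong₂ _*_ (sym (egf-s k)) (∑-cmp-pow (suc n) n (ℕ.n<1+n n) k))) ⟩
    ∑ (suc n) (λ k → egf s k * pow expm1 k n)
      ≡⟨ ∘ₚ-∑ (egf s) expm1 n ⟨
    (egf s ∘ₚ expm1) n
      ≡⟨ egf-∘-expm1 n ⟨
    egf e n ∎)
    where
    u : ℕ → ℚ
    u j = pow oneMinusExpNeg j n

-- Counting

-- Any choice of related partners is injective by `unique`, so sizes are compared from existence
-- statements without exhibiting a bijection.
card-≤ : ∀ {a b} {A B : Set} → Fin a ↔ A → Fin b ↔ B → (_~_ : A → B → Set) →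
         (∀ x → ∃ (x ~_)) → (∀ {x x′ y} → x ~ y → x′ ~ y → x ≡ x′) → a ℕ.≤ b
card-≤ α β _~_ total unique = injective⇒≤ {f = λ i → Inverse.from β (proj₁ (total (Inverse.to α i)))}
  λ {i} {j} eq → Injection.injective (↔⇒↣ α) (unique
    (subst (Inverse.to α i ~_) (Injection.injective (↔⇒↣ (↔-sym β)) eq) (proj₂ (total (Inverse.to α i))))
    (proj₂ (total (Inverse.to α j))))

card-≡ : ∀ {a b} {A B : Set} → Fin a ↔ A → Fin b ↔ B → (_~_ : A → B → Set) →
         (∀ x → ∃[ y ] x ~ y) → (∀ y → ∃[ x ] x ~ y) →
         (∀ {x x′ y} → x ~ y → x′ ~ y → x ≡ x′) → (∀ {x y y′} → x ~ y → x ~ y′ → y ≡ y′) → a ≡ b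
card-≡ α β _~_ totalˡ totalʳ uniqueˡ uniqueʳ = ℕ.≤-antisym
  (card-≤ α β _~_ totalˡ uniqueˡ) (card-≤ β α (λ y x → x ~ y) totalʳ uniqueʳ)

-- The bound `m` is left free so that the sums over `k` belonging to different `n` can share one
-- range.
Fin-Σ : ∀ m {B : ℕ → Set} (b : ℕ → ℕ) → (∀ k → Fin (b k) ↔ B k) → (∀ k → m ℕ.≤ k → ¬ B k) →
        Fin (sumℕ m b) ↔ Σ ℕ B
Fin-Σ zero    b enum empty = mk↔ₛ′ (λ ()) (λ (k , x) → ⊥-elim (empty k z≤n x))
  (λ (k , x) → ⊥-elim (empty k z≤n x)) (λ ())
Fin-Σ (suc m) {B} b enum empty = ↔-trans +↔⊎ (↔-trans
  (enum 0 ⊎-↔ Fin-Σ m (b ∘ suc) (enum ∘ suc) (λ k m≤k → empty (suc k) (s≤s m≤k)))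
  (mk↔ₛ′ (λ { (inj₁ x) → 0 , x ; (inj₂ (k , x)) → suc k , x })
         (λ { (zero , x) → inj₁ x ; (suc k , x) → inj₂ (k , x) })
         (λ { (zero , x) → refl ; (suc k , x) → refl })
         (λ { (inj₁ x) → refl ; (inj₂ (k , x)) → refl })))

-- Functions onto Fin k

-- The section is part of the data, so representatives of fibres are computed rather than chosen.
record Onto (n k : ℕ) : Set where
  field
    fun     : Fin n → Fin k
    sec     : Fin k → Fin n
    fun-sec : ∀ i → fun (sec i) ≡ i
open Onto

id-onto : ∀ {n} → Onto n n
id-onto = record { fun = id ; sec = id ; fun-sec = λ _ → refl }

infixr 9 _∘ₒ_
_∘ₒ_ : ∀ {n m k} → Onto m k → Onto n m → Onto n k
q ∘ₒ p = record { fun = fun q ∘ fun p ; sec = sec p ∘ sec q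
  ; fun-sec = λ i → trans (cong (fun q) (fun-sec p (sec q i))) (fun-sec q i) }

perm-onto : ∀ {n k} → Permutation n k → Onto n k
perm-onto π = record { fun = π ⟨$⟩ʳ_ ; sec = π ⟨$⟩ˡ_ ; fun-sec = λ _ → Perm.inverseʳ π }

module _ {n} {x x′ : Fin (suc n)} (x≢x′ : x ≢ x′) where

  -- The retraction sending `x′` to `x`, expressed in the indices that remain after `x′` is deleted.
  merge : Fin (suc n) → Fin n
  merge i with x′ ≟ i
  ... | yes _   = punchOut (x≢x′ ∘ sym)
  ... | no x′≢i = punchOut x′≢i

  merge-resp : ∀ {A : Set} (f : Fin (suc n) → A) → f x ≡ f x′ → ∀ i → f (punchIn x′ (merge i)) ≡ f i
  merge-resp f fx≡fx′ i with x′ ≟ i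
  ... | yes refl = trans (cong f (punchIn-punchOut (x≢x′ ∘ sym))) fx≡fx′
  ... | no x′≢i  = cong f (punchIn-punchOut x′≢i)

  merge-onto : Onto (suc n) n
  merge-onto = record { fun = merge ; sec = punchIn x′ ; fun-sec = merge-punchIn }
    where
    merge-punchIn : ∀ j → merge (punchIn x′ j) ≡ j
    merge-punchIn j with x′ ≟ punchIn x′ j
    ... | yes eq = contradiction (sym eq) (punchInᵢ≢i x′ j)
    ... | no  ne = trans (punchOut-cong x′ refl) (punchOut-punchIn x′)

collision? : ∀ {m n} (f : Fin m → Fin n) → Dec (∃₂ λ x x′ → x ≢ x′ × f x ≡ f x′)
collision? f = any? λ x → any? λ x′ → ¬? (x ≟ x′) ×-dec (f x ≟ f x′)

onto-permutation : ∀ {m n} (p : Onto m n) → ¬ (∃₂ λ x x′ → x ≢ x′ × fun p x ≡ fun p x′) → Permutation m n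
onto-permutation p inj = mk↔ₛ′ (fun p) (sec p) (fun-sec p) sec-fun
  where
  sec-fun : ∀ i → sec p (fun p i) ≡ i
  sec-fun i with sec p (fun p i) ≟ i
  ... | yes eq = eq
  ... | no  ne = contradiction (_ , i , ne , fun-sec p (fun p i)) inj

-- Restricted growth strings

-- Strings grow at the front, so each block is opened by its largest element, and blocks are
-- numbered by increasing largest element. This fixed numbering leaves exactly one string per set
-- partition.
data RGS : ℕ → ℕ → Set where
  []  : RGS 0 0
  new : ∀ {n k} → RGS n k → RGS (suc n) (suc k)
  old : ∀ {n k} → Fin k → RGS n k → RGS (suc n) k

cls : ∀ {n k} → RGS n k → Fin n → Fin k
cls (new r)   zero    = zero
cls (new r)   (suc j) = suc (cls r j)
cls (old i r) zero    = i
cls (old i r) (suc j) = cls r j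

rep : ∀ {n k} → RGS n k → Fin k → Fin n
rep (new r)   zero    = zero
rep (new r)   (suc i) = suc (rep r i)
rep (old _ r) i       = suc (rep r i)

cls-rep : ∀ {n k} (r : RGS n k) i → cls r (rep r i) ≡ i
cls-rep (new r)   zero    = refl
cls-rep (new r)   (suc i) = cong suc (cls-rep r i)
cls-rep (old _ r) i       = cls-rep r i

RGS-onto : ∀ {n k} → RGS n k → Onto n k
RGS-onto r = record { fun = cls r ; sec = rep r ; fun-sec = cls-rep r }

RGS-≤ : ∀ {n k} → RGS n k → k ℕ.≤ n
RGS-≤ []        = z≤n
RGS-≤ (new r)   = s≤s (RGS-≤ r)
RGS-≤ (old _ r) = ℕ.m≤n⇒m≤1+n (RGS-≤ r)

RGS-card : ∀ n k → Fin (S2 n k) ↔ RGS n k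
RGS-card zero    zero    = mk↔ₛ′ (λ _ → []) (λ _ → zero) (λ { [] → refl }) (λ { zero → refl })
RGS-card zero    (suc k) = mk↔ₛ′ (λ ()) (λ ()) (λ ()) (λ ())
RGS-card (suc n) zero    = mk↔ₛ′ (λ ()) (λ { (old () _) }) (λ { (old () _) }) (λ ())
RGS-card (suc n) (suc k) = ↔-trans +↔⊎ (↔-trans
  (RGS-card n k ⊎-↔ ↔-trans *↔× (↔-refl ×-↔ RGS-card n (suc k)))
  (mk↔ₛ′ (λ { (inj₁ r) → new r ; (inj₂ (i , r)) → old i r })
         (λ { (new r) → inj₁ r ; (old i r) → inj₂ (i , r) })
         (λ { (new r) → refl ; (old i r) → refl })
         (λ { (inj₁ r) → refl ; (inj₂ (i , r)) → refl })))

_≼_ : ∀ {n} {A B : Set} → (Fin n → A) → (Fin n → B) → Set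
f ≼ g = ∀ i j → f i ≡ f j → g i ≡ g j

-- The first value either recurs further on, which gives `old` with that block, or is fresh, which
-- gives `new`.
kernel-RGS : ∀ {n m} (f : Fin n → Fin m) → ∃₂ λ k (r : RGS n k) → (cls r ≼ f) × (f ≼ cls r)
kernel-RGS {zero}  f = 0 , [] , (λ ()) , (λ ())
kernel-RGS {suc n} f with kernel-RGS (f ∘ suc) | any? (λ j → f zero ≟ f (suc j))
... | k , r , r≼f , f≼r | yes (l , f0≡fl) = k , old (cls r l) r , to , from
  where
  to : cls (old (cls r l) r) ≼ f
  to zero    zero    _  = refl
  to zero    (suc j) eq = trans f0≡fl (r≼f l j eq)
  to (suc i) zero    eq = trans (r≼f i l eq) (sym f0≡fl)
  to (suc i) (suc j) eq = r≼f i j eq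
  from : f ≼ cls (old (cls r l) r)
  from zero    zero    _  = refl
  from zero    (suc j) eq = f≼r l j (trans (sym f0≡fl) eq)
  from (suc i) zero    eq = f≼r i l (trans eq f0≡fl)
  from (suc i) (suc j) eq = f≼r i j eq
... | k , r , r≼f , f≼r | no f0≢ = suc k , new r , to , from
  where
  to : cls (new r) ≼ f
  to zero    zero    _  = refl
  to (suc i) (suc j) eq = r≼f i j (suc-injective eq)
  from : f ≼ cls (new r)
  from zero    zero    _  = refl
  from zero    (suc j) eq = contradiction (j , eq) f0≢
  from (suc i) zero    eq = contradiction (i , sym eq) f0≢
  from (suc i) (suc j) eq = cong suc (f≼r i j eq)

RGS-unique : ∀ {n k k′} (r : RGS n k) (r′ : RGS n k′) → cls r ≼ cls r′ → cls r′ ≼ cls r →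
             _≡_ {A = ∃ (RGS n)} (k , r) (k′ , r′)
RGS-unique []        []          _ _ = refl
RGS-unique (new r)   (new r′)    h h′ with RGS-unique r r′
  (λ i j eq → suc-injective (h (suc i) (suc j) (cong suc eq)))
  (λ i j eq → suc-injective (h′ (suc i) (suc j) (cong suc eq)))
... | refl = refl
-- `old` ties element zero to a later representative, while `new` gives it a block of its own.
RGS-unique (new r)   (old i r′)  h h′ with () ← h′ (suc (rep r′ i)) zero (cls-rep r′ i)
RGS-unique (old i r) (new r′)    h h′ with () ← h (suc (rep r i)) zero (cls-rep r i)
RGS-unique (old i r) (old i′ r′) h h′ with RGS-unique r r′ (λ j l → h (suc j) (suc l)) (λ j l → h′ (suc j) (suc l))
... | refl = cong (λ x → _ , old x r) (trans (sym (cls-rep r i)) (h (suc (rep r i)) zero (cls-rep r i)))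

-- Compositions

-- `new` prepends a part equal to 1 and `old` increases the first part by 1.
data Comp : ℕ → ℕ → Set where
  []  : Comp 0 0
  new : ∀ {n k} → Comp n k → Comp (suc n) (suc k)
  old : ∀ {n k} → Comp n (suc k) → Comp (suc n) (suc k)

-- The weakly increasing surjection whose fibre sizes are the parts.
toRGS : ∀ {n k} → Comp n k → RGS n k
toRGS []      = []
toRGS (new c) = new (toRGS c)
toRGS (old c) = old zero (toRGS c)

part : ∀ {n k} → Comp n k → Fin n → Fin k
part c = cls (toRGS c)

Comp-card : ∀ n k → Fin (cmp n k) ↔ Comp n k
Comp-card zero    zero    = mk↔ₛ′ (λ _ → []) (λ _ → zero) (λ { [] → refl }) (λ { zero → refl })
Comp-card zero    (suc k) = mk↔ₛ′ (λ ()) (λ ()) (λ ()) (λ ())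
Comp-card (suc n) zero    = mk↔ₛ′ (λ ()) (λ ()) (λ ()) (λ ())
Comp-card (suc n) (suc k) = ↔-trans +↔⊎ (↔-trans
  (Comp-card n k ⊎-↔ Comp-card n (suc k))
  (mk↔ₛ′ (λ { (inj₁ c) → new c ; (inj₂ c) → old c })
         (λ { (new c) → inj₁ c ; (old c) → inj₂ c })
         (λ { (new c) → refl ; (old c) → refl })
         (λ { (inj₁ c) → refl ; (inj₂ c) → refl })))

transpose-resp : ∀ {n} {A : Set} (f : Fin n → A) a b → f a ≡ f b → ∀ i → f (Perm.transpose a b ⟨$⟩ʳ i) ≡ f i
transpose-resp f a b fa≡fb i with i ≟ a
... | yes refl = sym fa≡fb
... | no _ with i ≟ b
...   | yes refl = fa≡fb
...   | no _     = refl

-- `π` may move zero. Following it by the swap of `π ⟨$⟩ʳ zero` and zero does not affect `g`, which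
-- takes equal values at both, and the result fixes zero, so it restricts to the tail.
tail-permutation : ∀ {n} {A : Set} (f g : Fin (suc n) → A) → f zero ≡ g zero →
                   (π : Permutation (suc n) (suc n)) → (∀ j → f j ≡ g (π ⟨$⟩ʳ j)) →
                   ∃[ π′ ] (∀ j → f (suc j) ≡ g (suc (π′ ⟨$⟩ʳ j)))
tail-permutation f g f0≡g0 π f≡gπ = Perm.remove zero ρ , λ j → begin
  f (suc j)                             ≡⟨ f≡gπ (suc j) ⟩
  g (π ⟨$⟩ʳ suc j)                      ≡⟨ transpose-resp g (π ⟨$⟩ʳ zero) zero (trans (sym (f≡gπ zero)) f0≡g0) (π ⟨$⟩ʳ suc j) ⟨
  g (ρ ⟨$⟩ʳ suc j)                      ≡⟨ cong g (Perm.lift₀-remove ρ ρ0≡0 (suc j)) ⟨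
  g (suc (Perm.remove zero ρ ⟨$⟩ʳ j))   ∎
  where
  open ≡-Reasoning
  ρ = π ⨾ Perm.transpose (π ⟨$⟩ʳ zero) zero
  ρ0≡0 : ρ ⟨$⟩ʳ zero ≡ zero
  ρ0≡0 with (π ⟨$⟩ʳ zero) ≟ (π ⟨$⟩ʳ zero)
  ... | yes _ = refl
  ... | no ne = contradiction refl ne

-- A permutation of positions preserves fibre sizes, and these are the parts; the proof strips one
-- element of the first fibre at a time.
Comp-unique : ∀ {n k} (c c′ : Comp n k) (π : Permutation n n) → (∀ j → part c j ≡ part c′ (π ⟨$⟩ʳ j)) → c ≡ c′
Comp-unique []      []       π h = refl
Comp-unique (new c) (new c′) π h with tail-permutation (part (new c)) (part (new c′)) refl π h
... | π′ , h′ = cong new (Comp-unique c c′ π′ (suc-injective ∘ h′))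
Comp-unique (old c) (old c′) π h with tail-permutation (part (old c)) (part (old c′)) refl π h
... | π′ , h′ = cong old (Comp-unique c c′ π′ h′)
-- Class zero is exhausted on the left but occurs again in the tail on the right.
Comp-unique (new c) (old c′) π h with tail-permutation (part (new c)) (part (old c′)) refl π h
... | π′ , h′ with () ← trans (h′ (π′ ⟨$⟩ˡ rep (toRGS c′) zero))
                          (trans (cong (part c′) (Perm.inverseʳ π′)) (cls-rep (toRGS c′) zero))
Comp-unique (old c) (new c′) π h with tail-permutation (part (old c)) (part (new c′)) refl π h
... | π′ , h′ with () ← trans (sym (h′ (rep (toRGS c) zero))) (cls-rep (toRGS c) zero)

-- A preimage of zero is moved to the front. If zero occurs again, the tail is still onto and the
-- first part grows; otherwise the tail avoids zero and is sorted after its values are lowered.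
sort : ∀ {n k} (h : Fin n → Fin k) → (∀ i → ∃[ j ] h j ≡ i) →
       Σ[ c ∈ Comp n k ] Σ[ π ∈ Permutation n n ] ∀ j → h j ≡ part c (π ⟨$⟩ʳ j)
sort {zero}  {zero}  h onto = [] , Perm.id , λ ()
sort {zero}  {suc k} h onto with () ← proj₁ (onto zero)
sort {suc n} {zero}  h onto with () ← h zero
sort {suc n} {suc k} h onto = extend (any? (λ j → h′ (suc j) ≟ zero))
  where
  τ = Perm.transpose zero (proj₁ (onto zero))

  h′ : Fin (suc n) → Fin (suc k)
  h′ j = h (τ ⟨$⟩ʳ j)

  h′0 : h′ zero ≡ zero
  h′0 = proj₂ (onto zero)

  onto′ : ∀ i → ∃[ j ] h′ j ≡ i
  onto′ i with onto i
  ... | j , hj≡i = τ ⟨$⟩ˡ j , trans (cong h (Perm.inverseʳ τ)) hj≡i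

  unswap : (c : Comp (suc n) (suc k)) (π : Permutation n n) → (∀ j → h′ j ≡ part c (lift₀ π ⟨$⟩ʳ j)) →
           Σ[ c ∈ Comp (suc n) (suc k) ] Σ[ π ∈ Permutation (suc n) (suc n) ] ∀ j → h j ≡ part c (π ⟨$⟩ʳ j)
  unswap c π eq = c , Perm.flip τ ⨾ lift₀ π , λ j → trans (cong h (sym (Perm.inverseʳ τ))) (eq (τ ⟨$⟩ˡ j))

  extend : Dec (∃[ j ] h′ (suc j) ≡ zero) →
           Σ[ c ∈ Comp (suc n) (suc k) ] Σ[ π ∈ Permutation (suc n) (suc n) ] ∀ j → h j ≡ part c (π ⟨$⟩ʳ j)
  extend (yes (l , h′l≡0)) with sort (h′ ∘ suc) tail-onto
    where
    tail-onto : ∀ i → ∃[ j ] h′ (suc j) ≡ i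
    tail-onto i with onto′ i
    ... | suc j , eq = j , eq
    ... | zero  , eq = l , trans h′l≡0 (trans (sym h′0) eq)
  ... | c , π , eq = unswap (old c) π λ { zero → h′0 ; (suc j) → eq j }
  extend (no 0∉) with sort (λ j → punchOut (0≢ j)) tail-onto
    where
    0≢ : ∀ j → zero ≢ h′ (suc j)
    0≢ j eq = 0∉ (j , sym eq)
    tail-onto : ∀ i → ∃[ j ] punchOut (0≢ j) ≡ i
    tail-onto i with onto′ (suc i)
    ... | suc j , eq = j , suc-injective (trans (punchIn-punchOut (0≢ j)) eq)
    ... | zero  , eq with () ← trans (sym h′0) eq
  ... | c , π , eq = unswap (new c) π
    λ { zero → h′0 ; (suc j) → trans (sym (punchIn-punchOut (λ e → 0∉ (j , sym e)))) (cong suc (eq j)) }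

-- Enumeration of permutations

-- A Lehmer code whose leading digit is the image of zero. Permutations carry inverses and proofs,
-- so bijectivity is stated up to pointwise equality.
decode : ∀ k → Fin (k !) → Permutation k k
decode zero    _ = Perm.id
decode (suc k) i = uncurry (λ a l → Perm.insert zero a (decode k l)) (remQuot {suc k} (k !) i)

decode-surjective : ∀ k (π : Permutation k k) → ∃[ i ] (∀ j → decode k i ⟨$⟩ʳ j ≡ π ⟨$⟩ʳ j)
decode-surjective zero    π = zero , λ ()
decode-surjective (suc k) π with decode-surjective k (Perm.remove zero π)
... | i , eq = combine (π ⟨$⟩ʳ zero) i , λ j → trans
  (cong (λ p → uncurry (λ a l → Perm.insert zero a (decode k l)) p ⟨$⟩ʳ j) (remQuot-combine (π ⟨$⟩ʳ zero) i))
  (insert≡π j)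
  where
  insert≡π : ∀ j → Perm.insert zero (π ⟨$⟩ʳ zero) (decode k i) ⟨$⟩ʳ j ≡ π ⟨$⟩ʳ j
  insert≡π zero    = refl
  insert≡π (suc j) = trans (cong (punchIn (π ⟨$⟩ʳ zero)) (eq j)) (sym (Perm.punchIn-permute π zero j))

decode-injective : ∀ k {i i′} → (∀ j → decode k i ⟨$⟩ʳ j ≡ decode k i′ ⟨$⟩ʳ j) → i ≡ i′
decode-injective zero    {zero} {zero} _ = refl
decode-injective (suc k) {i} {i′} eq = trans (sym (combine-remQuot {suc k} (k !) i))
  (trans (cong₂ combine (eq zero) (decode-injective k tail-eq)) (combine-remQuot {suc k} (k !) i′))
  where
  tail-eq : ∀ j → decode k (proj₂ (remQuot {suc k} (k !) i)) ⟨$⟩ʳ j ≡ decode k (proj₂ (remQuot {suc k} (k !) i′)) ⟨$⟩ʳ j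
  tail-eq j = punchIn-injective (proj₁ (remQuot {suc k} (k !) i)) _ _
    (trans (eq (suc j)) (cong (λ a → punchIn a (decode k (proj₂ (remQuot {suc k} (k !) i′)) ⟨$⟩ʳ j)) (sym (eq zero))))

-- Pulling posets back along functions

entry : ∀ {n} → BRel n → Fin n → Fin n → Bool
entry R i j = lookup (lookup R i) j

pullback : ∀ {n k} → (Fin n → Fin k) → BRel k → BRel n
pullback f Q = tabulate λ i → tabulate λ j → entry Q (f i) (f j)

entry-pullback : ∀ {n k} (f : Fin n → Fin k) Q i j → entry (pullback f Q) i j ≡ entry Q (f i) (f j)
entry-pullback f Q i j = trans (cong (λ row → lookup row j) (lookup∘tabulate (λ i → tabulate λ j → entry Q (f i) (f j)) i))
  (lookup∘tabulate (λ j → entry Q (f i) (f j)) j)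

entry-injective : ∀ {n} {R S : BRel n} → (∀ i j → entry R i j ≡ entry S i j) → R ≡ S
entry-injective {R = R} {S} eq = begin
  R                   ≡⟨ tabulate∘lookup R ⟨
  tabulate (lookup R) ≡⟨ tabulate-cong (λ i → begin
    lookup R i                     ≡⟨ tabulate∘lookup (lookup R i) ⟨
    tabulate (lookup (lookup R i)) ≡⟨ tabulate-cong (eq i) ⟩
    tabulate (lookup (lookup S i)) ≡⟨ tabulate∘lookup (lookup S i) ⟩
    lookup S i                     ∎) ⟩
  tabulate (lookup S) ≡⟨ tabulate∘lookup S ⟩
  S                   ∎
  where open ≡-Reasoning

pullback-poset : ∀ {n k} (f : Fin n → Fin k) Q → IsPoset Q → IsPoset (pullback f Q)
pullback-poset f Q (irrefl , transitive) =
    (λ i i<i → irrefl (f i) (trans (sym (entry-pullback f Q i i)) i<i))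
  , (λ i j l i<j j<l → trans (entry-pullback f Q i l) (transitive (f i) (f j) (f l)
      (trans (sym (entry-pullback f Q i j)) i<j) (trans (sym (entry-pullback f Q j l)) j<l)))

≡⇒⇔ : ∀ {b c : Bool} → b ≡ c → (b ≡ true) ⇔ (c ≡ true)
≡⇒⇔ refl = mk⇔ id id

permutation⇒Iso : ∀ {n m} {P : BRel n} {Q : BRel m} (π : Permutation n m) →
                  (∀ i j → entry P i j ≡ entry Q (π ⟨$⟩ʳ i) (π ⟨$⟩ʳ j)) → Iso P Q
permutation⇒Iso π eq = record
  { to = π ⟨$⟩ʳ_ ; from = π ⟨$⟩ˡ_ ; from∘to = λ _ → Perm.inverseˡ π ; to∘from = λ _ → Perm.inverseʳ π
  ; preserve = λ i j → ≡⇒⇔ (eq i j) }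

Iso⇒permutation : ∀ {n m} {P : BRel n} {Q : BRel m} → Iso P Q → Permutation n m
Iso⇒permutation φ = mk↔ₛ′ (Iso.to φ) (Iso.from φ) (Iso.to∘from φ) (Iso.from∘to φ)

Iso-entry : ∀ {n m} {P : BRel n} {Q : BRel m} (φ : Iso P Q) i j → entry P i j ≡ entry Q (Iso.to φ i) (Iso.to φ j)
Iso-entry φ i j = Bool.⇔→≡ (Iso.preserve φ i j)

Iso-refl : ∀ {n} {P : BRel n} → Iso P P
Iso-refl = permutation⇒Iso Perm.id (λ _ _ → refl)

Iso-sym : ∀ {n m} {P : BRel n} {Q : BRel m} → Iso P Q → Iso Q P
Iso-sym {P = P} {Q} φ = permutation⇒Iso (Perm.flip (Iso⇒permutation φ))
  (λ i j → sym (trans (Iso-entry φ (Iso.from φ i) (Iso.from φ j)) (cong₂ (entry Q) (Iso.to∘from φ i) (Iso.to∘from φ j))))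

Iso-trans : ∀ {n m l} {P : BRel n} {Q : BRel m} {R : BRel l} → Iso P Q → Iso Q R → Iso P R
Iso-trans φ ψ = permutation⇒Iso (Iso⇒permutation φ ⨾ Iso⇒permutation ψ)
  (λ i j → trans (Iso-entry φ i j) (Iso-entry ψ (Iso.to φ i) (Iso.to φ j)))

pullback-Iso : ∀ {n k} (π : Permutation n k) Q → Iso (pullback (π ⟨$⟩ʳ_) Q) Q
pullback-Iso π Q = permutation⇒Iso π (entry-pullback (π ⟨$⟩ʳ_) Q)

-- Twins are exchangeable or equal.

record Twin {n} (P : BRel n) (i j : Fin n) : Set where
  constructor twin
  field
    above : ∀ y → entry P i y ≡ entry P j y
    below : ∀ y → entry P y i ≡ entry P y j
open Twin

Exchangeable⇒Twin : ∀ {n} {P : BRel n} {i j} → Exchangeable P i j → Twin P i j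
Exchangeable⇒Twin (_ , _ , _ , ex) = twin (λ y → Bool.⇔→≡ (proj₁ (ex y))) (λ y → Bool.⇔→≡ (proj₂ (ex y)))

-- Incomparability comes from irreflexivity: with equal rows, `i < j` would give `j < j`.
Twin⇒Exchangeable : ∀ {n} {P : BRel n} {i j} → IsPoset P → i ≢ j → Twin P i j → Exchangeable P i j
Twin⇒Exchangeable {i = i} {j} (irrefl , _) i≢j tw = i≢j
  , (λ i<j → irrefl j (trans (sym (above tw j)) i<j))
  , (λ j<i → irrefl i (trans (above tw i) j<i))
  , (λ y → ≡⇒⇔ (above tw y) , ≡⇒⇔ (below tw y))

seed-Twin : ∀ {n} {P : BRel n} {i j} → IsPoset P → IsSeed P → Twin P i j → i ≡ j
seed-Twin {i = i} {j} poset seed tw with i ≟ j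
... | yes i≡j = i≡j
... | no  i≢j = contradiction (Twin⇒Exchangeable poset i≢j tw) (seed i j)

record IsPullback {n k} (f : Fin n → Fin k) (P : BRel n) (Q : BRel k) : Set where
  constructor isPullback
  field entries : ∀ i j → entry P i j ≡ entry Q (f i) (f j)
open IsPullback

pullback-IsPullback : ∀ {n k} (f : Fin n → Fin k) {P Q} → P ≡ pullback f Q → IsPullback f P Q
pullback-IsPullback f {Q = Q} refl = isPullback (entry-pullback f Q)

≡⇒Twin : ∀ {n k} {f : Fin n → Fin k} {P Q} → IsPullback f P Q → ∀ {i j} → f i ≡ f j → Twin P i j
≡⇒Twin {f = f} {Q = Q} pb {i} {j} fi≡fj = twin
  (λ y → trans (entries pb i y) (trans (cong (λ x → entry Q x (f y)) fi≡fj) (sym (entries pb j y))))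
  (λ y → trans (entries pb y i) (trans (cong (entry Q (f y)) fi≡fj) (sym (entries pb y j))))

-- Twins of `P` are compared in `Q` only at values of `fun p`; the section makes every element of
-- `Q` such a value.
Twin-pullback : ∀ {n k} (p : Onto n k) {P Q} → IsPullback (fun p) P Q → ∀ {i j} → Twin P i j → Twin Q (fun p i) (fun p j)
Twin-pullback p {P} {Q} pb {i} {j} tw = twin
  (λ y → subst (λ y → entry Q (fun p i) y ≡ entry Q (fun p j) y) (fun-sec p y)
    (trans (sym (entries pb i (sec p y))) (trans (above tw (sec p y)) (entries pb j (sec p y)))))
  (λ y → subst (λ y → entry Q y (fun p i) ≡ entry Q y (fun p j)) (fun-sec p y)
    (trans (sym (entries pb (sec p y) i)) (trans (below tw (sec p y)) (entries pb (sec p y) j))))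

Iso-Twin : ∀ {n m} {P : BRel n} {Q : BRel m} (φ : Iso P Q) {i j} → Twin P i j → Twin Q (Iso.to φ i) (Iso.to φ j)
Iso-Twin φ = Twin-pullback (perm-onto (Iso⇒permutation φ)) (isPullback (Iso-entry φ))

-- By `≡⇒Twin` and `Twin⇒≡` the fibres of `quotient` are exactly the twin classes of `P`, so they
-- depend on `P` alone.
record SeedPresentation {n} (P : BRel n) {k} (Q : BRel k) : Set where
  field
    seed-poset : IsPoset Q
    seed       : IsSeed Q
    onto       : Onto n k
    isPull     : IsPullback (fun onto) P Q

  quotient : Fin n → Fin k
  quotient = fun onto

  Twin⇒≡ : ∀ {i j} → Twin P i j → quotient i ≡ quotient j
  Twin⇒≡ tw = seed-Twin seed-poset seed (Twin-pullback onto isPull tw)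
open SeedPresentation

refines : ∀ {n k k′} {P : BRel n} {Q : BRel k} {Q′ : BRel k′} (A : SeedPresentation P Q) (A′ : SeedPresentation P Q′) →
          ∀ {i j} → quotient A i ≡ quotient A j → quotient A′ i ≡ quotient A′ j
refines A A′ eq = Twin⇒≡ A′ (≡⇒Twin (isPull A) eq)

-- An isomorphism carries twin classes to twin classes and so descends to the quotients. The
-- commuting square is what later lets primitivity compare the two surjections.
seeds-Iso : ∀ {n m k k′} {P : BRel n} {P′ : BRel m} {Q : BRel k} {Q′ : BRel k′}
            (A : SeedPresentation P Q) (A′ : SeedPresentation P′ Q′) (φ : Iso P P′) →
            Σ[ ψ ∈ Iso Q Q′ ] (∀ i → Iso.to ψ (quotient A i) ≡ quotient A′ (Iso.to φ i))
seeds-Iso {Q = Q} {Q′} A A′ φ = permutation⇒Iso σ σ-entry , λ i → to-resp (fun-sec p (fun p i))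
  where
  p  = onto A
  p′ = onto A′

  to-resp : ∀ {i j} → fun p i ≡ fun p j → fun p′ (Iso.to φ i) ≡ fun p′ (Iso.to φ j)
  to-resp eq = Twin⇒≡ A′ (Iso-Twin φ (≡⇒Twin (isPull A) eq))

  from-resp : ∀ {i j} → fun p′ i ≡ fun p′ j → fun p (Iso.from φ i) ≡ fun p (Iso.from φ j)
  from-resp eq = Twin⇒≡ A (Iso-Twin (Iso-sym φ) (≡⇒Twin (isPull A′) eq))

  σ : Permutation _ _
  σ = mk↔ₛ′ (λ i → fun p′ (Iso.to φ (sec p i))) (λ i → fun p (Iso.from φ (sec p′ i)))
    (λ i → trans (to-resp (fun-sec p _)) (trans (cong (fun p′) (Iso.to∘from φ (sec p′ i))) (fun-sec p′ i)))
    (λ i → trans (from-resp (fun-sec p′ _)) (trans (cong (fun p) (Iso.from∘to φ (sec p i))) (fun-sec p i)))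

  σ-entry : ∀ i j → entry Q i j ≡ entry Q′ (σ ⟨$⟩ʳ i) (σ ⟨$⟩ʳ j)
  σ-entry i j = trans (sym (trans (entries (isPull A) (sec p i) (sec p j)) (cong₂ (entry Q) (fun-sec p i) (fun-sec p j))))
    (trans (Iso-entry φ (sec p i) (sec p j)) (entries (isPull A′) _ _))

-- Gardens

-- Each cloning contributes the map merging the clone into its original; an exchangeable pair has
-- equal rows and columns, so merging keeps every entry.
Sprout⇒pullback : ∀ {m k} {P : BRel m} {Q : BRel k} → Sprout P Q → Σ[ p ∈ Onto m k ] IsPullback (fun p) P Q
Sprout⇒pullback here = id-onto , isPullback (λ _ _ → refl)
Sprout⇒pullback {suc m} {P = P′} {Q} (clone {P = P} (x , x′ , ex , φ) s) with Sprout⇒pullback s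
... | p , pb = p ∘ₒ perm-onto (Iso⇒permutation φ) ∘ₒ merge-onto (proj₁ ex) , isPullback λ i j → begin
  entry P′ i j                            ≡⟨ merge-resp x≢x′ (λ i → entry P′ i j) (above tw j) i ⟨
  entry P′ (punchIn x′ (q i)) j           ≡⟨ merge-resp x≢x′ (entry P′ (punchIn x′ (q i))) (below tw (punchIn x′ (q i))) j ⟨
  entry P′ (punchIn x′ (q i)) (punchIn x′ (q j)) ≡⟨ entry-pullback (punchIn x′) P′ (q i) (q j) ⟨
  entry (delete P′ x′) (q i) (q j)        ≡⟨ Iso-entry φ (q i) (q j) ⟩
  entry P (Iso.to φ (q i)) (Iso.to φ (q j)) ≡⟨ entries pb _ _ ⟩
  entry Q (fun p (Iso.to φ (q i))) (fun p (Iso.to φ (q j))) ∎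
  where
  open ≡-Reasoning
  x≢x′ = proj₁ ex
  q = merge x≢x′
  tw : Twin P′ x x′
  tw = Exchangeable⇒Twin ex

IsSeed? : ∀ {n} (P : BRel n) → Dec (IsSeed P)
IsSeed? P = all? λ x → all? λ x′ → ¬? (¬? (x ≟ x′) ×-dec ¬? (x <? x′) ×-dec ¬? (x′ <? x)
  ×-dec all? λ y → ((x <? y) ⇔? (x′ <? y)) ×-dec ((y <? x) ⇔? (y <? x′)))
  where
  _<?_ : ∀ i j → Dec (P ⊢ i < j)
  i <? j = entry P i j Bool.≟ true
  _⇔?_ : ∀ {A B : Set} → Dec A → Dec B → Dec (A ⇔ B)
  a ⇔? b = map′ (uncurry mk⇔) (λ e → Equivalence.to e , Equivalence.from e) ((a →-dec b) ×-dec (b →-dec a))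

-- Counted families

record Reps (_≈_ : ∀ {n} → BRel n → BRel n → Set) (C : PosetClass) (n c : ℕ) : Set where
  field
    at           : Fin c → BRel n
    at-injective : ∀ {i j} → at i ≈ at j → i ≡ j
    poset        : ∀ i → IsPoset (at i)
    member       : ∀ i → C (at i)
    complete     : ∀ R → IsPoset R → C R → ∃[ i ] R ≈ at i

-- `AllPairs` compares earlier entries with later ones only; symmetry covers the other order.
lookup-injective : ∀ {A : Set} {_≈_ : A → A → Set} → Symmetric _≈_ → ∀ {xs} → AllPairs (λ x y → ¬ x ≈ y) xs →
                   ∀ {i j} → (xs !! i) ≈ (xs !! j) → i ≡ j
lookup-injective ≈-sym (_ ∷ _)     {zero}  {zero}  _  = refl
lookup-injective ≈-sym (x∉ ∷ _)    {zero}  {suc j} eq = contradiction eq (All.lookup x∉ (∈-lookup j))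
lookup-injective ≈-sym (x∉ ∷ _)    {suc i} {zero}  eq = contradiction (≈-sym eq) (All.lookup x∉ (∈-lookup i))
lookup-injective ≈-sym (_ ∷ pairs) {suc i} {suc j} eq = cong suc (lookup-injective ≈-sym pairs eq)

labelled-Reps : ∀ {C : PosetClass} {n c} → LabelledCount C n c → Reps _≡_ C n c
labelled-Reps (L , unique , refl , mem) = record
  { at           = L !!_
  ; at-injective = lookup-injective sym unique
  ; poset        = λ i → proj₁ (Equivalence.to (mem _) (∈-lookup i))
  ; member       = λ i → proj₂ (Equivalence.to (mem _) (∈-lookup i))
  ; complete     = λ R poset CR → let R∈L = Equivalence.from (mem R) (poset , CR) in
                     Any.index R∈L , Any.lookup-index R∈L
  }

isoClass-Reps : ∀ {C : PosetClass} {n c} → IsoClassCount C n c → Reps Iso C n c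
isoClass-Reps (L , pairs , refl , members , complete) = record
  { at           = L !!_
  ; at-injective = lookup-injective Iso-sym pairs
  ; poset        = λ i → proj₁ (All.lookup members (∈-lookup i))
  ; member       = λ i → proj₂ (All.lookup members (∈-lookup i))
  ; complete     = λ R poset CR → Any.index (complete R poset CR) , Any.lookup-index (complete R poset CR)
  }

-- Gardens of primitive seeds: the three counting formulas

module _ (X : PosetClass)
  (X-props : ∀ {n} {P : BRel n} → X P → IsPoset P × IsSeed P × IsPrimitive P)
  (X-closed : ∀ {n m} {P : BRel n} {Q : BRel m} → X P → Iso P Q → X Q) where

  X-poset : ∀ {n} {P : BRel n} → X P → IsPoset P
  X-poset = proj₁ ∘ X-props

  X-seed : ∀ {n} {P : BRel n} → X P → IsSeed P
  X-seed XP = proj₁ (proj₂ (X-props XP))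

  X-primitive : ∀ {n} {P : BRel n} → X P → IsPrimitive P
  X-primitive XP = proj₂ (proj₂ (X-props XP))

  member-presented : ∀ {_≈_ : ∀ {n} → BRel n → BRel n → Set} {k c} (T : Reps _≈_ X k c) i {n} {P : BRel n} (p : Onto n k) →
                     P ≡ pullback (fun p) (Reps.at T i) → SeedPresentation P (Reps.at T i)
  member-presented T i p eq = record
    { seed-poset = Reps.poset T i
    ; seed       = X-seed (Reps.member T i)
    ; onto       = p
    ; isPull     = pullback-IsPullback (fun p) eq
    }

  -- Converse of `Sprout⇒pullback`, by induction on the size of `P`. Two elements with the same
  -- image are exchangeable, so one of them can be deleted as a clone; once `fun p` is injective,
  -- `P` is isomorphic to `Q` and lies in `X`.
  pullback⇒Garden : ∀ {m k} {P : BRel m} {Q : BRel k} → X Q → (p : Onto m k) → IsPullback (fun p) P Q →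
                    Garden X P
  pullback⇒Garden {P = P} {Q} XQ p pb with collision? (fun p)
  pullback⇒Garden {m} {P = P} {Q} XQ p pb | no inj =
    m , P , X-closed XQ (Iso-sym (permutation⇒Iso (onto-permutation p inj) (entries pb))) , here
  pullback⇒Garden {suc m} {P = P} {Q} XQ p pb | yes (x , x′ , x≢x′ , px≡px′)
    with pullback⇒Garden XQ p′ (isPullback λ i j → trans (entry-pullback (punchIn x′) P i j) (entries pb _ _))
    where
    p′ : Onto m _
    -- The old section may hit the deleted `x′`; `merge` moves it to `x`, which has the same image.
    p′ = record { fun = fun p ∘ punchIn x′ ; sec = merge x≢x′ ∘ sec p
      ; fun-sec = λ i → trans (merge-resp x≢x′ (fun p) px≡px′ (sec p i)) (fun-sec p i) }
  ... | k , Q₀ , XQ₀ , s = k , Q₀ , XQ₀ , clone (x , x′ , exchange , Iso-refl) s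
    where
    tw = ≡⇒Twin pb px≡px′
    irrefl : ∀ i → ¬ (P ⊢ i < i)
    irrefl i i<i = proj₁ (X-poset XQ) (fun p i) (trans (sym (entries pb i i)) i<i)
    exchange : Exchangeable P x x′
    exchange = x≢x′
      , (λ x<x′ → irrefl x′ (trans (sym (above tw x′)) x<x′))
      , (λ x′<x → irrefl x (trans (above tw x) x′<x))
      , (λ y → ≡⇒⇔ (above tw y) , ≡⇒⇔ (below tw y))

  -- A last cloning step would leave an exchangeable pair, so the cloning sequence is empty.
  Garden∧seed⇒X : ∀ {n} {P : BRel n} → Garden X P → IsSeed P → X P
  Garden∧seed⇒X (_ , _ , XQ , here)                  seed = XQ
  Garden∧seed⇒X (_ , _ , _ , clone (x , x′ , ex , _) _) seed = contradiction ex (seed x x′)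

  -- The filter loses no class of `X`: a representative isomorphic to a member of `X` is itself in
  -- `X`, hence a seed.
  seed-classes : ∀ {n c} → IsoClassCount (Garden X) n c → ∃ (IsoClassCount X n)
  seed-classes (L , pairs , _ , members , complete) = length L′ , L′ , AllPairs.filter⁺ IsSeed? pairs , refl
    , All.zipWith (λ ((poset , gP) , seed) → poset , Garden∧seed⇒X gP seed) (All.filter⁺ IsSeed? members , All.all-filter IsSeed? L)
    , complete′
    where
    L′ = filter IsSeed? L
    complete′ : ∀ R → IsPoset R → X R → Any (Iso R) L′
    complete′ R poset XR with complete R poset (_ , R , XR , here)
    ... | any with Any.filter⁺ IsSeed? any
    ...   | inj₁ found   = found
    ...   | inj₂ notSeed = contradiction (X-seed (X-closed XR (Any.lookup-result any))) notSeed

  module _ {k s t} (S : Reps _≡_ X k s) (T : Reps Iso X k t) where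
    open Reps

    -- Each class contributes one labelling per permutation, and primitivity makes these labellings
    -- distinct.
    labelled-by-classes : s ≡ k ! ℕ.* t
    labelled-by-classes = card-≡ ↔-refl *↔× (λ i (l , c) → at S i ≡ pullback (decode k l ⟨$⟩ʳ_) (at T c))
      totalˡ totalʳ (λ eq eq′ → at-injective S (trans eq (sym eq′))) uniqueʳ
      where
      totalˡ : ∀ i → ∃[ (l , c) ] at S i ≡ pullback (decode k l ⟨$⟩ʳ_) (at T c)
      totalˡ i with complete T (at S i) (poset S i) (member S i)
      ... | c , φ with decode-surjective k (Iso⇒permutation φ)
      ...   | l , eq = (l , c) , entry-injective λ a b → trans (Iso-entry φ a b)
        (sym (trans (entry-pullback (decode k l ⟨$⟩ʳ_) (at T c) a b) (cong₂ (entry (at T c)) (eq a) (eq b))))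

      totalʳ : ∀ ((l , c) : Fin (k !) × Fin t) → ∃[ i ] at S i ≡ pullback (decode k l ⟨$⟩ʳ_) (at T c)
      totalʳ (l , c) = map₂ sym (complete S _ (pullback-poset (decode k l ⟨$⟩ʳ_) (at T c) (poset T c))
        (X-closed (member T c) (Iso-sym (pullback-Iso (decode k l) (at T c)))))

      uniqueʳ : ∀ {i} {y y′ : Fin (k !) × Fin t} → at S i ≡ pullback (decode k (proj₁ y) ⟨$⟩ʳ_) (at T (proj₂ y)) →
                at S i ≡ pullback (decode k (proj₁ y′) ⟨$⟩ʳ_) (at T (proj₂ y′)) → y ≡ y′
      uniqueʳ {i} {l , c} {l′ , c′} eq eq′
        with seeds-Iso (member-presented T c (perm-onto (decode k l)) eq) (member-presented T c′ (perm-onto (decode k l′)) eq′) (Iso-refl {P = at S i})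
      ... | ψ , ψ-commutes with at-injective T ψ
      -- `ψ` is now an automorphism, hence the identity, and the two permutations agree pointwise.
      ...   | refl = cong (_, c) (decode-injective k λ j →
        trans (sym (X-primitive (member T c) ψ (decode k l ⟨$⟩ʳ j))) (ψ-commutes j))

  module _ {n e} {s : ℕ → ℕ} (E : Reps _≡_ (Garden X) n e) (S : ∀ k → Reps _≡_ X k (s k)) where
    open Reps

    labelled-garden : e ≡ sumℕ (suc n) (λ k → s k ℕ.* S2 n k)
    labelled-garden = card-≡ ↔-refl
      (Fin-Σ (suc n) (λ k → s k ℕ.* S2 n k) (λ k → ↔-trans *↔× (↔-refl ×-↔ RGS-card n k))
        (λ k n<k (_ , r) → ℕ.<⇒≱ n<k (RGS-≤ r)))
      (λ i (k , q , r) → at E i ≡ pullback (cls r) (at (S k) q))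
      totalˡ totalʳ (λ eq eq′ → at-injective E (trans eq (sym eq′))) uniqueʳ
      where
      totalˡ : ∀ i → ∃[ (k , q , r) ] at E i ≡ pullback (cls r) (at (S k) q)
      totalˡ i with member E i
      ... | k , Q , XQ , sprout with Sprout⇒pullback sprout
      ...   | p , pb with kernel-RGS (fun p)
      ...     | k′ , r , r≼p , p≼r with complete (S k′) Q′ (pullback-poset f Q (X-poset XQ)) (X-closed XQ (Iso-sym (pullback-Iso σ Q)))
        where
        -- `rep r` picks one element of each fibre of `fun p`, so `f` is a bijection that renumbers
        -- the blocks. Relabelling `Q` along it turns the pullback into an exact equality with a
        -- counted seed.
        f : Fin k′ → Fin k
        f = fun p ∘ rep r
        Q′ : BRel k′
        Q′ = pullback f Q
        σ : Permutation k′ k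
        σ = mk↔ₛ′ f (cls r ∘ sec p)
          (λ j → trans (r≼p _ _ (cls-rep r _)) (fun-sec p j))
          (λ j → trans (p≼r _ _ (fun-sec p _)) (cls-rep r j))
      ...       | q , Q′≡ = (k′ , q , r) , trans (entry-injective λ a b → begin
        entry (at E i) a b                        ≡⟨ entries pb a b ⟩
        entry Q (fun p a) (fun p b)               ≡⟨ cong₂ (entry Q) (r≼p _ _ (cls-rep r (cls r a))) (r≼p _ _ (cls-rep r (cls r b))) ⟨
        entry Q (fun p (rep r (cls r a))) (fun p (rep r (cls r b))) ≡⟨ entry-pullback _ Q (cls r a) (cls r b) ⟨
        entry (pullback (fun p ∘ rep r) Q) (cls r a) (cls r b)      ≡⟨ entry-pullback (cls r) (pullback (fun p ∘ rep r) Q) a b ⟨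
        entry (pullback (cls r) (pullback (fun p ∘ rep r) Q)) a b   ∎) (cong (pullback (cls r)) Q′≡)
        where open ≡-Reasoning

      totalʳ : ∀ ((k , q , r) : ∃ λ k → Fin (s k) × RGS n k) → ∃[ i ] at E i ≡ pullback (cls r) (at (S k) q)
      totalʳ (k , q , r) = map₂ sym (complete E _ (pullback-poset (cls r) (at (S k) q) (poset (S k) q))
        (pullback⇒Garden (member (S k) q) (RGS-onto r) (pullback-IsPullback (cls r) refl)))

      uniqueʳ : ∀ {i} {y y′ : ∃ λ k → Fin (s k) × RGS n k} →
                at E i ≡ pullback (cls (proj₂ (proj₂ y))) (at (S (proj₁ y)) (proj₁ (proj₂ y))) →
                at E i ≡ pullback (cls (proj₂ (proj₂ y′))) (at (S (proj₁ y′)) (proj₁ (proj₂ y′))) → y ≡ y′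
      uniqueʳ {i} {k , q , r} {k′ , q′ , r′} eq eq′ with RGS-unique r r′
        (λ _ _ → refines (member-presented (S k) q (RGS-onto r) eq) (member-presented (S k′) q′ (RGS-onto r′) eq′))
        (λ _ _ → refines (member-presented (S k′) q′ (RGS-onto r′) eq′) (member-presented (S k) q (RGS-onto r) eq))
      -- With the string fixed, the entries at its representatives recover the seed.
      ... | refl = cong (λ q → k , q , r) (at-injective (S k) (entry-injective λ a b → begin
        entry (at (S k) q) a b   ≡⟨ cong₂ (entry (at (S k) q)) (cls-rep r a) (cls-rep r b) ⟨
        entry (at (S k) q) (cls r (rep r a)) (cls r (rep r b))  ≡⟨ entry-pullback (cls r) (at (S k) q) (rep r a) (rep r b) ⟨
        entry (pullback (cls r) (at (S k) q)) (rep r a) (rep r b) ≡⟨ cong (λ R → entry R (rep r a) (rep r b)) (trans (sym eq) eq′) ⟩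
        entry (pullback (cls r) (at (S k) q′)) (rep r a) (rep r b) ≡⟨ entry-pullback (cls r) (at (S k) q′) (rep r a) (rep r b) ⟩
        entry (at (S k) q′) (cls r (rep r a)) (cls r (rep r b)) ≡⟨ cong₂ (entry (at (S k) q′)) (cls-rep r a) (cls-rep r b) ⟩
        entry (at (S k) q′) a b  ∎))
        where open ≡-Reasoning

  module _ {n o} {t : ℕ → ℕ} (G : Reps Iso (Garden X) n o) (T : ∀ k → Reps Iso X k (t k)) where
    open Reps

    garden-classes : ∀ m → n ℕ.< m → o ≡ sumℕ m (λ k → t k ℕ.* cmp n k)
    garden-classes m n<m = card-≡ ↔-refl
      (Fin-Σ m (λ k → t k ℕ.* cmp n k) (λ k → ↔-trans *↔× (↔-refl ×-↔ Comp-card n k))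
        (λ k m≤k (_ , c) → ℕ.<⇒≱ (ℕ.<-≤-trans n<m m≤k) (RGS-≤ (toRGS c))))
      (λ i (k , q , c) → Iso (at G i) (pullback (part c) (at (T k) q)))
      totalˡ totalʳ (λ φ φ′ → at-injective G (Iso-trans φ (Iso-sym φ′))) uniqueʳ
      where
      totalˡ : ∀ i → ∃[ (k , q , c) ] Iso (at G i) (pullback (part c) (at (T k) q))
      totalˡ i with member G i
      ... | k , Q , XQ , sprout with Sprout⇒pullback sprout | complete (T k) Q (X-poset XQ) XQ
      -- The surjection is carried over to the class representative before sorting, so its fibres
      -- are listed in the fixed order of that representative's elements.
      ...   | p , pb | q , φ with sort (fun p′) (λ j → sec p′ j , fun-sec p′ j)
        where
        p′ : Onto n k
        p′ = perm-onto (Iso⇒permutation φ) ∘ₒ p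
      ...     | c , π , sorted = (k , q , c) , permutation⇒Iso π λ a b → begin
        entry (at G i) a b                        ≡⟨ entries pb a b ⟩
        entry Q (fun p a) (fun p b)               ≡⟨ Iso-entry φ _ _ ⟩
        entry (at (T k) q) (Iso.to φ (fun p a)) (Iso.to φ (fun p b)) ≡⟨ cong₂ (entry (at (T k) q)) (sorted a) (sorted b) ⟩
        entry (at (T k) q) (part c (π ⟨$⟩ʳ a)) (part c (π ⟨$⟩ʳ b))   ≡⟨ entry-pullback (part c) (at (T k) q) _ _ ⟨
        entry (pullback (part c) (at (T k) q)) (π ⟨$⟩ʳ a) (π ⟨$⟩ʳ b) ∎
        where open ≡-Reasoning

      totalʳ : ∀ ((k , q , c) : ∃ λ k → Fin (t k) × Comp n k) → ∃[ i ] Iso (at G i) (pullback (part c) (at (T k) q))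
      totalʳ (k , q , c) = map₂ Iso-sym (complete G _ (pullback-poset (part c) (at (T k) q) (poset (T k) q))
        (pullback⇒Garden (member (T k) q) (RGS-onto (toRGS c)) (pullback-IsPullback (part c) refl)))

      uniqueʳ : ∀ {i} {y y′ : ∃ λ k → Fin (t k) × Comp n k} →
                Iso (at G i) (pullback (part (proj₂ (proj₂ y))) (at (T (proj₁ y)) (proj₁ (proj₂ y)))) →
                Iso (at G i) (pullback (part (proj₂ (proj₂ y′))) (at (T (proj₁ y′)) (proj₁ (proj₂ y′)))) → y ≡ y′
      uniqueʳ {i} {k , q , c} {k′ , q′ , c′} φ φ′
        with seeds-Iso (member-presented (T k) q (RGS-onto (toRGS c)) refl) (member-presented (T k′) q′ (RGS-onto (toRGS c′)) refl)
               (Iso-trans (Iso-sym φ) φ′)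
      -- The sizes are identified first, since `at-injective` works within a single `T k`.
      ... | ψ , ψ-commutes with Perm.↔⇒≡ (Iso⇒permutation ψ)
      ...   | refl with at-injective (T k) ψ
      -- `ψ` is the identity by primitivity, so the two words differ only by a permutation of
      -- positions.
      ...     | refl = cong (λ c → k , q , c) (Comp-unique c c′ (Iso⇒permutation (Iso-trans (Iso-sym φ) φ′))
        λ j → trans (sym (X-primitive (member (T k) q) ψ (part c j))) (ψ-commutes j))

theorem4p1 : (X : PosetClass)
    → (∀ {n} {P : BRel n} → X P → IsPoset P × IsSeed P × IsPrimitive P)
    → (∀ {n m} {P : BRel n} {Q : BRel m} → X P → Iso P Q → X Q)
    → (o e s : ℕ → ℕ)
    → (∀ n → IsoClassCount (Garden X) n (o n))
    → (∀ n → LabelledCount (Garden X) n (e n))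
    → (∀ n → LabelledCount X n (s n))
    → (∀ n → egf e n ≡ (egf s ∘ₚ expm1) n)
    × (∀ n → egf e n ≡ (ogf o ∘ₚ oneMinusExpNeg) n)
    × (∀ n → ogf o n ≡ (egf s ∘ₚ geomx) n)
theorem4p1 X X-props X-closed o e s o-count e-count s-count =
    egf-∘-expm1 o e s t s≡ e≡ o≡ , egf-∘-oneMinusExpNeg o e s t s≡ e≡ o≡ , ogf-∘-geomx o e s t s≡ e≡ o≡
  where
  classes : ∀ k → ∃ (IsoClassCount X k)
  classes k = seed-classes X X-props X-closed (o-count k)

  t : ℕ → ℕ
  t k = proj₁ (classes k)

  S : ∀ k → Reps _≡_ X k (s k)
  S k = labelled-Reps (s-count k)

  T : ∀ k → Reps Iso X k (t k)
  T k = isoClass-Reps (proj₂ (classes k))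

  s≡ : ∀ k → s k ≡ k ! ℕ.* t k
  s≡ k = labelled-by-classes X X-props X-closed (S k) (T k)

  e≡ : ∀ n → e n ≡ sumℕ (suc n) (λ k → s k ℕ.* S2 n k)
  e≡ n = labelled-garden X X-props X-closed (labelled-Reps (e-count n)) S

  o≡ : ∀ m n → n ℕ.< m → o n ≡ sumℕ m (λ k → t k ℕ.* cmp n k)
  o≡ m n = garden-classes X X-props X-closed (isoClass-Reps (o-count n)) T m
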